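{- Let $n$ be a positive integer and let $\mathcal{F}$ be a family of subsets of $[n]=\{1,\dots,n\}$ that is diamond-free, i.e. there do not exist four distinct sets $A,B,C,D\in\mathcal{F}$ with $A\subset B\subset D$ and $A\subset C\subset D$ (the sets $B$ and $C$ may or may not be comparable). Then $$|\mathcal{F}|\le (2.25+o(1))\binom{n}{\lfloor n/2\rfloor},$$ where $o(1)$ denotes a quantity depending only on $n$ that tends to $0$ as $n\to\infty$ (uniformly over all such families $\mathcal{F}$).
   Context: The $n$-dimensional Boolean lattice $\mathcal{B}_n$ is the poset $(2^{[n]},\subseteq)$. The diamond $\mathcal{B}_2$ is the poset on four elements $A<B,C<D$; a family is diamond-free if it contains no (weak) copy of this poset, as spelled out in the claim. -}

module Defs where

open import Data.Nat using (ℕ)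
open import Data.List using (List)
open import Data.List.Membership.Propositional using (_∈_)
open import Data.Fin.Subset using (Subset; _⊂_)
open import Data.Product using (Σ; _×_)
open import Relation.Nullary using (¬_)
open import Relation.Binary.PropositionalEquality using (_≢_)

-- A family of subsets of [n] is a duplicate-free list of subsets
-- (Subset n = Vec Bool n, the characteristic vector); its size is the length.

-- A diamond in F: four distinct members A,B,C,D with A ⊂ B ⊂ D, A ⊂ C ⊂ D
-- (⊂ strict).  Strictness already forces A,B,C,D pairwise distinct except
-- possibly B = C, so B ≢ C is required explicitly.
Diamond : {n : ℕ} → List (Subset n) → Set
Diamond {n} F =
  Σ (Subset n) λ A → Σ (Subset n) λ B → Σ (Subset n) λ C → Σ (Subset n) λ D →
    (A ∈ F) × (B ∈ F) × (C ∈ F) × (D ∈ F) ×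
    (A ⊂ B) × (B ⊂ D) × (A ⊂ C) × (C ⊂ D) × (B ≢ C)

DiamondFree : {n : ℕ} → List (Subset n) → Set
DiamondFree F = ¬ Diamond F

{-# OPTIONS --safe #-}

-- Average over maximal chains the number of members of F met (the Lubell function).  Descending to the
-- first member A met, it suffices that, above a member A with m = n - ∣ A ∣ large, a random chain meets
-- at most 9/4 + O(1/m) members.  No member strictly contains two members lying strictly above A (diamond-freeness),
-- so a chain meets at most two members above A, and the issue is the excess of "two" over "none".
--
-- Record which sets A + i and A + i + j are members.  A triple with q ≥ 1 such members below it has
-- excess at most q/3 - 1 + [q = 1].  For the chains whose triple has none, the excess is a sum over
-- members D with a unique member t strictly between A and D, at relative heights d > k ≥ 3, of which only
-- a fraction 1 / C(d, k) ≤ 1/4 of the chains from A to D passes through t; hence it is at most 1/4 of the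
-- density of the quadruples without such members.  That the resulting density expression on vertex- and
-- edge-marked graphs is at most 1/4 + O(1/m) is shown by a sum of squares on quadruples.
--
-- Members within a bounded distance of the full set are negligible against the central binomial
-- coefficient, and the others have large m.
module Submission where

open import Defs
open import Data.Bool using (Bool; true; false; not; _∧_; _∨_; if_then_else_) renaming (T to IsTrue)
open import Data.Bool.Properties using () renaming (_≟_ to _≟ᵇ_)
open import Data.Empty using (⊥; ⊥-elim)
open import Data.Fin using (Fin; zero; suc) renaming (_≟_ to _≟ᶠ_)
open import Data.Fin.Subset using (Subset; ∣_∣; _⊆_; _⊂_) renaming (_∈_ to _∈ˢ_; ⊥ to ∅)
open import Data.Fin.Subset.Properties
  using (_⊂?_; ⊂-⊆-trans; ⊂-irref; ⊂-trans; ⊥⊆; p⊂q⇒∣p∣<∣q∣; p⊆q⇒∣p∣≤∣q∣; drop-∷-⊆; out⊂; in⊂in; out⊂in; ∣p∣≤n; ∣⊥∣≡0)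
open import Data.Integer as ℤ using (ℤ; +_; +≤+; 1ℤ)
import Data.Integer.Properties as ℤₚ
open import Data.List using (List; []; _∷_; length; filter)
open import Data.List.Membership.Propositional using (_∈_; find; lose)
open import Data.List.Membership.Propositional.Properties using (∈-filter⁻)
open import Data.List.Relation.Unary.All as All using (All; []; _∷_)
open import Data.List.Relation.Unary.All.Properties using (all-filter)
open import Data.List.Relation.Unary.AllPairs using ([]; _∷_)
open import Data.List.Relation.Unary.Any using (any?; here; there)
open import Data.List.Relation.Unary.Unique.Propositional using (Unique)
open import Data.List.Relation.Unary.Unique.Propositional.Properties using (filter⁺)
open import Data.Nat as ℕ using (ℕ; zero; suc; _!; ⌊_/2⌋; ⌈_/2⌉; z≤n; s≤s)
open import Data.Nat.Combinatorics using (_C_; nCk≡n!/k![n-k]!; k![n∸k]!∣n!)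
open import Data.Nat.DivMod using (m/n*n≡m)
import Data.Nat.Properties as ℕₚ
open import Data.Nat.Tactic.RingSolver using () renaming (solve-∀ to solveℕ-∀)
open import Data.Product using (Σ; ∃; _×_; _,_; proj₁; proj₂)
open import Data.Sum using (_⊎_; inj₁; inj₂)
open import Data.Unit using (tt)
open import Data.Vec using (Vec; []; _∷_; lookup; _[_]≔_; here)
open import Data.Vec.Properties
  using (lookup∘update; lookup∘update′; lookup⇒[]=; []=⇒lookup; []≔-idempotent; []≔-lookup; []≔-commutes; ≡-dec)
open import Relation.Binary.Definitions using (DecidableEquality)
open import Relation.Binary.PropositionalEquality
  using (_≡_; _≢_; refl; sym; trans; cong; cong₂; subst; ≢-sym; module ≡-Reasoning)
open import Relation.Nullary using (Dec; yes; no; does; ¬?)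
open import Relation.Nullary.Decidable using (_×-dec_; dec-true)
open import Relation.Unary using (Pred; Decidable)

module _ where

  open import Data.Integer using (-[1+_]; 0ℤ; _+_; _*_; _-_; -_; _≤_; _≤ᵇ_)
  open import Data.Integer.Tactic.RingSolver using (solve-∀)
  open import Algebra.Properties.Semiring.Sum ℤₚ.+-*-semiring
    using (sum; sum-cong-≗; ∑-distrib-+; ∑-comm; *-distribˡ-sum)

  private variable
    n : ℕ

  -- Adding elements to a subset and removing them

  infixl 7 _⊕_ _⊝_

  _⊕_ _⊝_ : Subset n → Fin n → Subset n
  S ⊕ i = S [ i ]≔ true
  S ⊝ i = S [ i ]≔ false

  ∣⊕∣ : (S : Subset n) (i : Fin n) → lookup S i ≡ false → ∣ S ⊕ i ∣ ≡ suc ∣ S ∣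
  ∣⊕∣ (false ∷ S) zero    _ = refl
  ∣⊕∣ (true  ∷ S) (suc i) p = cong suc (∣⊕∣ S i p)
  ∣⊕∣ (false ∷ S) (suc i) p = ∣⊕∣ S i p

  ⊕-comm : (S : Subset n) (i j : Fin n) → S ⊕ i ⊕ j ≡ S ⊕ j ⊕ i
  ⊕-comm S i j with i ≟ᶠ j
  ... | yes refl = refl
  ... | no i≢j   = []≔-commutes S i j i≢j

  ⊕-⊝ : (S : Subset n) (i : Fin n) → lookup S i ≡ false → (S ⊕ i) ⊝ i ≡ S
  ⊕-⊝ S i p = trans ([]≔-idempotent S i) (trans (cong (S [ i ]≔_) (sym p)) ([]≔-lookup S i))

  ⊝-⊕ : (S : Subset n) (i : Fin n) → lookup S i ≡ true → (S ⊝ i) ⊕ i ≡ S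
  ⊝-⊕ S i p = trans ([]≔-idempotent S i) (trans (cong (S [ i ]≔_) (sym p)) ([]≔-lookup S i))

  lookup-⊕-mono : (S : Subset n) (i j : Fin n) → lookup S j ≡ true → lookup (S ⊕ i) j ≡ true
  lookup-⊕-mono S i j p with j ≟ᶠ i
  ... | yes refl = lookup∘update i S true
  ... | no j≢i   = trans (lookup∘update′ j≢i S true) p

  lookup-⊕⁻ : (S : Subset n) (i j : Fin n) → lookup (S ⊕ i) j ≡ false → lookup S j ≡ false
  lookup-⊕⁻ S i j p with lookup S j in eq
  ... | false = refl
  ... | true  with trans (sym (lookup-⊕-mono S i j eq)) p
  ...   | ()

  ∉⊕⇒≢ : (S : Subset n) (i j : Fin n) → lookup (S ⊕ i) j ≡ false → i ≢ j
  ∉⊕⇒≢ S i .i p refl with trans (sym (lookup∘update i S true)) p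
  ... | ()

  -- Sums over the complement of a set

  -- Elements of the set contribute 0 instead of being left out, so that every sum runs over all of
  -- `Fin n` and the general lemmas on finite sums apply.
  pick : Bool → ℤ → ℤ
  pick true  _ = 0ℤ
  pick false x = x

  Σ∉ : Subset n → (Fin n → ℤ) → ℤ
  Σ∉ S f = sum (λ i → pick (lookup S i) (f i))

  sum-mono : {f g : Fin n → ℤ} → (∀ i → f i ≤ g i) → sum f ≤ sum g
  sum-mono {zero}  _ = ℤₚ.≤-refl
  sum-mono {suc n} p = ℤₚ.+-mono-≤ (p zero) (sum-mono (λ i → p (suc i)))

  pick-cong : ∀ b {x y} → (b ≡ false → x ≡ y) → pick b x ≡ pick b y
  pick-cong true  _ = refl
  pick-cong false p = p refl

  pick-mono : ∀ b {x y} → (b ≡ false → x ≤ y) → pick b x ≤ pick b y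
  pick-mono true  _ = ℤₚ.≤-refl
  pick-mono false p = p refl

  pick-0 : ∀ b → pick b 0ℤ ≡ 0ℤ
  pick-0 true  = refl
  pick-0 false = refl

  pick-comm : ∀ b c x → pick b (pick c x) ≡ pick c (pick b x)
  pick-comm true  c x = sym (pick-0 c)
  pick-comm false c x = refl

  pick-+ : ∀ b x y → pick b (x + y) ≡ pick b x + pick b y
  pick-+ true  _ _ = refl
  pick-+ false _ _ = refl

  pick-* : ∀ b c x → pick b (c * x) ≡ c * pick b x
  pick-* true  c _ = sym (ℤₚ.*-zeroʳ c)
  pick-* false _ _ = refl

  Σ∉-cong : (S : Subset n) {f g : Fin n → ℤ} →
    (∀ i → lookup S i ≡ false → f i ≡ g i) → Σ∉ S f ≡ Σ∉ S g
  Σ∉-cong S p = sum-cong-≗ (λ i → pick-cong (lookup S i) (p i))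

  Σ∉-mono : (S : Subset n) {f g : Fin n → ℤ} →
    (∀ i → lookup S i ≡ false → f i ≤ g i) → Σ∉ S f ≤ Σ∉ S g
  Σ∉-mono S p = sum-mono (λ i → pick-mono (lookup S i) (p i))

  Σ∉-+ : (S : Subset n) (f g : Fin n → ℤ) → Σ∉ S (λ i → f i + g i) ≡ Σ∉ S f + Σ∉ S g
  Σ∉-+ S f g = trans (sum-cong-≗ (λ i → pick-+ (lookup S i) (f i) (g i)))
    (∑-distrib-+ (λ i → pick (lookup S i) (f i)) (λ i → pick (lookup S i) (g i)))

  Σ∉-* : (S : Subset n) (c : ℤ) (f : Fin n → ℤ) → Σ∉ S (λ i → c * f i) ≡ c * Σ∉ S f
  Σ∉-* S c f = trans (sum-cong-≗ (λ i → pick-* (lookup S i) c (f i)))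
    (sym (*-distribˡ-sum c (λ i → pick (lookup S i) (f i))))

  -- The equation `∣ S ∣ + r ≡ n`, free of truncated subtraction, is the invariant handed from level
  -- to level in all the chain sums below.
  Σ∉-const : (S : Subset n) {r : ℕ} → ∣ S ∣ ℕ.+ r ≡ n → (c : ℤ) → Σ∉ S (λ _ → c) ≡ + r * c
  Σ∉-const [] {zero} _ c = refl
  Σ∉-const (true ∷ S) p c = trans (ℤₚ.+-identityˡ _) (Σ∉-const S (ℕₚ.suc-injective p) c)
  Σ∉-const (false ∷ S) {zero} p c =
    ⊥-elim (ℕₚ.<-irrefl (trans (sym (ℕₚ.+-identityʳ _)) p) (ℕ.s≤s (∣p∣≤n S)))
  Σ∉-const (false ∷ S) {suc r} p c = trans
    (cong (λ x → c + x) (Σ∉-const S (ℕₚ.suc-injective (trans (sym (ℕₚ.+-suc ∣ S ∣ r)) p)) c))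
    (sym (ℤₚ.suc-* (+ r) c))

  Σ∉-⊕ : (S : Subset n) (k : Fin n) → lookup S k ≡ false → (f : Fin n → ℤ) →
    Σ∉ S f ≡ f k + Σ∉ (S ⊕ k) f
  Σ∉-⊕ (false ∷ S) zero    _ f = cong (λ x → f zero + x) (sym (ℤₚ.+-identityˡ _))
  Σ∉-⊕ (b ∷ S)     (suc k) p f = trans
    (cong (λ x → pick b (f zero) + x) (Σ∉-⊕ S k p (λ i → f (suc i))))
    (rearrange (pick b (f zero)) (f (suc k)) _)
    where
    rearrange : ∀ x y z → x + (y + z) ≡ y + (x + z)
    rearrange = solve-∀

  Σ∉-zero : (S : Subset n) → Σ∉ S (λ _ → 0ℤ) ≡ 0ℤ
  Σ∉-zero S = Σ∉-* S 0ℤ (λ _ → 0ℤ)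

  Σ∉-nonNeg : (S : Subset n) {f : Fin n → ℤ} → (∀ i → lookup S i ≡ false → 0ℤ ≤ f i) → 0ℤ ≤ Σ∉ S f
  Σ∉-nonNeg S p = ℤₚ.≤-trans (ℤₚ.≤-reflexive (sym (Σ∉-zero S))) (Σ∉-mono S p)

  -- Both sides are sums over ordered pairs of distinct elements outside S.
  Σ∉-swap : (S : Subset n) (f : Fin n → Fin n → ℤ) →
    Σ∉ S (λ i → Σ∉ (S ⊕ i) (f i)) ≡ Σ∉ S (λ j → Σ∉ (S ⊕ j) (λ i → f i j))
  Σ∉-swap {n} S f = trans (sum-cong-≗ {n} (λ i → pick-sum (lookup S i) _))
    (trans (∑-comm {n} {n} (λ i j → pick (lookup S i) (pick (lookup (S ⊕ i) j) (f i j))))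
    (sum-cong-≗ (λ j → trans (sum-cong-≗ (λ i → pointwise i j)) (sym (pick-sum (lookup S j) _)))))
    where
    pick-sum : ∀ b (g : Fin n → ℤ) → pick b (sum g) ≡ sum (λ j → pick b (g j))
    pick-sum true  g = *-distribˡ-sum {n} 0ℤ (λ _ → 0ℤ)
    pick-sum false g = refl

    pointwise : ∀ i j → pick (lookup S i) (pick (lookup (S ⊕ i) j) (f i j)) ≡
                        pick (lookup S j) (pick (lookup (S ⊕ j) i) (f i j))
    pointwise i j with i ≟ᶠ j
    ... | yes refl = refl
    ... | no i≢j rewrite lookup∘update′ (≢-sym i≢j) S true
                       | lookup∘update′ i≢j S true = pick-comm (lookup S i) (lookup S j) (f i j)

  -- Sums over the ordered ways to add s elements to a set

  U : ℕ → (Subset n → ℤ) → Subset n → ℤ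
  U zero    f S = f S
  U (suc s) f S = Σ∉ S (λ i → U s f (S ⊕ i))

  -- Recursion parallel to that of `U`: comparing two sums then requires information only at the
  -- sets R that occur in them.
  data Reach {n : ℕ} : ℕ → Subset n → Subset n → Set where
    done : ∀ {S} → Reach zero S S
    add  : ∀ {s S R} i → lookup S i ≡ false → Reach s (S ⊕ i) R → Reach (suc s) S R

  Reach-lookup : ∀ {s} {S R : Subset n} → Reach s S R → ∀ i → lookup S i ≡ true → lookup R i ≡ true
  Reach-lookup done         i p = p
  Reach-lookup {S = S} (add j _ q) i p = Reach-lookup q i (lookup-⊕-mono S j i p)

  Reach-size : ∀ {s} {S R : Subset n} → Reach s S R → ∣ R ∣ ≡ ∣ S ∣ ℕ.+ s
  Reach-size done = sym (ℕₚ.+-identityʳ _)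
  Reach-size {S = S} (add {s} i p q) = trans (Reach-size q)
    (trans (cong (ℕ._+ s) (∣⊕∣ S i p)) (sym (ℕₚ.+-suc ∣ S ∣ s)))

  U-cong : ∀ s {f g : Subset n → ℤ} (S : Subset n) →
    (∀ R → Reach s S R → f R ≡ g R) → U s f S ≡ U s g S
  U-cong zero    S p = p S done
  U-cong (suc s) S p = Σ∉-cong S (λ i e → U-cong s (S ⊕ i) (λ R q → p R (add i e q)))

  U-mono : ∀ s {f g : Subset n → ℤ} (S : Subset n) →
    (∀ R → Reach s S R → f R ≤ g R) → U s f S ≤ U s g S
  U-mono zero    S p = p S done
  U-mono (suc s) S p = Σ∉-mono S (λ i e → U-mono s (S ⊕ i) (λ R q → p R (add i e q)))

  U-+ : ∀ s (f g : Subset n → ℤ) (S : Subset n) → U s (λ R → f R + g R) S ≡ U s f S + U s g S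
  U-+ zero    f g S = refl
  U-+ (suc s) f g S = trans (Σ∉-cong S (λ i _ → U-+ s f g (S ⊕ i))) (Σ∉-+ S _ _)

  U-* : ∀ s (c : ℤ) (f : Subset n → ℤ) (S : Subset n) → U s (λ R → c * f R) S ≡ c * U s f S
  U-* zero    c f S = refl
  U-* (suc s) c f S = trans (Σ∉-cong S (λ i _ → U-* s c f (S ⊕ i))) (Σ∉-* S c _)

  U-last : ∀ s (f : Subset n → ℤ) (S : Subset n) →
    U (suc s) f S ≡ U s (λ R → Σ∉ R (λ i → f (R ⊕ i))) S
  U-last zero    f S = refl
  U-last (suc s) f S = Σ∉-cong S (λ i _ → U-last s f (S ⊕ i))

  -- The element added last may as well be added first.
  U-last-first : ∀ s (φ : Subset n → Fin n → ℤ) (A : Subset n) →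
    U s (λ S → Σ∉ S (φ S)) A ≡ Σ∉ A (λ j → U s (λ R → φ (R ⊝ j) j) (A ⊕ j))
  U-last-first zero φ A = Σ∉-cong A (λ j p → cong (λ S → φ S j) (sym (⊕-⊝ A j p)))
  U-last-first (suc s) φ A = begin
    Σ∉ A (λ i → U s (λ S → Σ∉ S (φ S)) (A ⊕ i))
      ≡⟨ Σ∉-cong A (λ i _ → U-last-first s φ (A ⊕ i)) ⟩
    Σ∉ A (λ i → Σ∉ (A ⊕ i) (λ j → U s (ψ j) (A ⊕ i ⊕ j)))
      ≡⟨ Σ∉-swap A _ ⟩
    Σ∉ A (λ j → Σ∉ (A ⊕ j) (λ i → U s (ψ j) (A ⊕ i ⊕ j)))
      ≡⟨ Σ∉-cong A (λ j _ → Σ∉-cong (A ⊕ j) (λ i _ → cong (U s (ψ j)) (⊕-comm A i j))) ⟩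
    Σ∉ A (λ j → U (suc s) (ψ j) (A ⊕ j)) ∎
    where
    open ≡-Reasoning
    ψ : Fin _ → Subset _ → ℤ
    ψ j R = φ (R ⊝ j) j

  -- Ranges over the i in R outside A, that is, over the elements that may have been added last on
  -- the way from A to R. The `not` turns `pick`, which keeps absent elements, into a filter for
  -- present ones.
  Ψ : (Subset n → Fin n → ℤ) → Subset n → Subset n → ℤ
  Ψ φ A R = Σ∉ A (λ i → pick (not (lookup R i)) (φ (R ⊝ i) i))

  Ψ-⊕ : (φ : Subset n → Fin n → ℤ) (A R : Subset n) (j : Fin n) → lookup A j ≡ false → lookup R j ≡ true →
    Ψ φ A R ≡ φ (R ⊝ j) j + Ψ φ (A ⊕ j) R
  Ψ-⊕ φ A R j j∉A j∈R = trans (Σ∉-⊕ A j j∉A _)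
    (cong (_+ Ψ φ (A ⊕ j) R) (cong (λ b → pick (not b) (φ (R ⊝ j) j)) j∈R))

  Ψ-self : (φ : Subset n → Fin n → ℤ) (A : Subset n) → Ψ φ A A ≡ 0ℤ
  Ψ-self φ A = trans (Σ∉-cong A (λ i p → trans (cong (λ b → pick (not b) (φ (A ⊝ i) i)) p) refl))
    (Σ∉-zero A)

  -- Averaging over which of the s + 1 added elements comes last.
  U-symmetrise : ∀ s (φ : Subset n → Fin n → ℤ) (A : Subset n) →
    + suc s * U s (λ S → Σ∉ S (φ S)) A ≡ U (suc s) (Ψ φ A) A
  U-symmetrise zero φ A = trans (ℤₚ.*-identityˡ _) (Σ∉-cong A (λ j p → sym (begin
    Ψ φ A (A ⊕ j)                               ≡⟨ Ψ-⊕ φ A (A ⊕ j) j p (lookup∘update j A true) ⟩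
    φ (A ⊕ j ⊝ j) j + Ψ φ (A ⊕ j) (A ⊕ j)     ≡⟨ cong₂ _+_ (cong (λ S → φ S j) (⊕-⊝ A j p)) (Ψ-self φ (A ⊕ j)) ⟩
    φ A j + 0ℤ                                  ≡⟨ ℤₚ.+-identityʳ _ ⟩
    φ A j                                       ∎)))
    where open ≡-Reasoning
  U-symmetrise (suc s) φ A = sym (begin
    Σ∉ A (λ j → U (suc s) (Ψ φ A) (A ⊕ j))
      -- With j added first, `Ψ` splits into the term that takes j as the last element and the terms
      -- for the other elements, which are those of the induction hypothesis at `A ⊕ j`.
      ≡⟨ Σ∉-cong A (λ j p → trans
           (U-cong (suc s) (A ⊕ j) (λ R q → Ψ-⊕ φ A R j p (Reach-lookup q j (lookup∘update j A true))))
           (U-+ (suc s) (λ R → φ (R ⊝ j) j) (Ψ φ (A ⊕ j)) (A ⊕ j))) ⟩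
    Σ∉ A (λ j → U (suc s) (λ R → φ (R ⊝ j) j) (A ⊕ j) + U (suc s) (Ψ φ (A ⊕ j)) (A ⊕ j))
      ≡⟨ Σ∉-+ A _ _ ⟩
    Σ∉ A (λ j → U (suc s) (λ R → φ (R ⊝ j) j) (A ⊕ j)) + Σ∉ A (λ j → U (suc s) (Ψ φ (A ⊕ j)) (A ⊕ j))
      ≡⟨ cong₂ _+_ (sym (U-last-first (suc s) φ A))
           (trans (Σ∉-cong A (λ j _ → sym (U-symmetrise s φ (A ⊕ j)))) (Σ∉-* A (+ suc s) _)) ⟩
    U (suc s) f A + + suc s * U (suc s) f A
      ≡⟨ sym (ℤₚ.suc-* (+ suc s) (U (suc s) f A)) ⟩
    + suc (suc s) * U (suc s) f A ∎)
    where
    open ≡-Reasoning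
    f : Subset _ → ℤ
    f S = Σ∉ S (φ S)

  Ψ-const : ∀ {s} {B R : Subset n} (c : ℤ) → Reach s B R → Ψ (λ _ _ → c) B R ≡ + s * c
  Ψ-const {B = B} c done = Ψ-self (λ _ _ → c) B
  Ψ-const {B = B} {R} c (add {s} i p q) = trans
    (Ψ-⊕ (λ _ _ → c) B R i p (Reach-lookup q i (lookup∘update i B true)))
    (trans (cong (λ x → c + x) (Ψ-const c q)) (sym (ℤₚ.suc-* (+ s) c)))

  Ψ-cong : ∀ (φ ψ : Subset n → Fin n → ℤ) B R →
    (∀ i → lookup B i ≡ false → lookup R i ≡ true → φ (R ⊝ i) i ≡ ψ (R ⊝ i) i) → Ψ φ B R ≡ Ψ ψ B R
  Ψ-cong φ ψ B R p = Σ∉-cong B (λ i i∉B → pick-cong (not (lookup R i)) (λ e → p i i∉B (not-false e)))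
    where
    not-false : ∀ {b} → not b ≡ false → b ≡ true
    not-false {true} _ = refl

  Ψ-nonPos : ∀ (φ : Subset n → Fin n → ℤ) B R →
    (∀ i → lookup B i ≡ false → lookup R i ≡ true → φ (R ⊝ i) i ≤ 0ℤ) → Ψ φ B R ≤ 0ℤ
  Ψ-nonPos φ B R p = ℤₚ.≤-trans
    (Σ∉-mono B {g = λ _ → 0ℤ} (λ i i∉B → bound i i∉B))
    (ℤₚ.≤-reflexive (Σ∉-zero B))
    where
    bound : ∀ i → lookup B i ≡ false → pick (not (lookup R i)) _ ≤ 0ℤ
    bound i i∉B with lookup R i in eq
    ... | true  = p i i∉B eq
    ... | false = ℤₚ.≤-refl

  -- Sums over ordered tuples of distinct elements outside A

  Σ² : Subset n → (Fin n → Fin n → ℤ) → ℤ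
  Σ² A f = Σ∉ A (λ i → Σ∉ (A ⊕ i) (f i))

  Σ³ : Subset n → (Fin n → Fin n → Fin n → ℤ) → ℤ
  Σ³ A f = Σ∉ A (λ i → Σ² (A ⊕ i) (f i))

  Σ⁴ : Subset n → (Fin n → Fin n → Fin n → Fin n → ℤ) → ℤ
  Σ⁴ A f = Σ∉ A (λ i → Σ³ (A ⊕ i) (f i))

  Σ³-+ : (A : Subset n) (f g : Fin n → Fin n → Fin n → ℤ) → Σ³ A (λ i j k → f i j k + g i j k) ≡ Σ³ A f + Σ³ A g
  Σ³-+ A f g = trans (Σ∉-cong A (λ i _ → trans
    (Σ∉-cong (A ⊕ i) (λ j _ → Σ∉-+ (A ⊕ i ⊕ j) (f i j) (g i j))) (Σ∉-+ (A ⊕ i) _ _))) (Σ∉-+ A _ _)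

  Σ³-* : (A : Subset n) (c : ℤ) (f : Fin n → Fin n → Fin n → ℤ) → Σ³ A (λ i j k → c * f i j k) ≡ c * Σ³ A f
  Σ³-* A c f = trans (Σ∉-cong A (λ i _ → trans
    (Σ∉-cong (A ⊕ i) (λ j _ → Σ∉-* (A ⊕ i ⊕ j) c (f i j))) (Σ∉-* (A ⊕ i) c _))) (Σ∉-* A c _)

  Σ⁴-+ : (A : Subset n) (f g : Fin n → Fin n → Fin n → Fin n → ℤ) →
    Σ⁴ A (λ i j k l → f i j k l + g i j k l) ≡ Σ⁴ A f + Σ⁴ A g
  Σ⁴-+ A f g = trans (Σ∉-cong A (λ i _ → Σ³-+ (A ⊕ i) (f i) (g i))) (Σ∉-+ A _ _)

  Σ⁴-* : (A : Subset n) (c : ℤ) (f : Fin n → Fin n → Fin n → Fin n → ℤ) →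
    Σ⁴ A (λ i j k l → c * f i j k l) ≡ c * Σ⁴ A f
  Σ⁴-* A c f = trans (Σ∉-cong A (λ i _ → Σ³-* (A ⊕ i) c (f i))) (Σ∉-* A c _)

  Σ³-swap₁₂ : (A : Subset n) (f : Fin n → Fin n → Fin n → ℤ) → Σ³ A f ≡ Σ³ A (λ i j k → f j i k)
  Σ³-swap₁₂ A f = trans (Σ∉-swap A (λ i j → Σ∉ (A ⊕ i ⊕ j) (f i j)))
    (Σ∉-cong A (λ j _ → Σ∉-cong (A ⊕ j) (λ i _ → cong (λ S → Σ∉ S (f i j)) (⊕-comm A i j))))

  Σ³-swap₂₃ : (A : Subset n) (f : Fin n → Fin n → Fin n → ℤ) → Σ³ A f ≡ Σ³ A (λ i j k → f i k j)
  Σ³-swap₂₃ A f = Σ∉-cong A (λ i _ → Σ∉-swap (A ⊕ i) (f i))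

  Σ⁴-swap₁₂ : (A : Subset n) (f : Fin n → Fin n → Fin n → Fin n → ℤ) → Σ⁴ A f ≡ Σ⁴ A (λ i j k l → f j i k l)
  Σ⁴-swap₁₂ A f = trans (Σ∉-swap A (λ i j → Σ² (A ⊕ i ⊕ j) (f i j)))
    (Σ∉-cong A (λ j _ → Σ∉-cong (A ⊕ j) (λ i _ → cong (λ S → Σ² S (f i j)) (⊕-comm A i j))))

  Σ⁴-swap₂₃ : (A : Subset n) (f : Fin n → Fin n → Fin n → Fin n → ℤ) → Σ⁴ A f ≡ Σ⁴ A (λ i j k l → f i k j l)
  Σ⁴-swap₂₃ A f = Σ∉-cong A (λ i _ → Σ³-swap₁₂ (A ⊕ i) (f i))

  Σ⁴-swap₃₄ : (A : Subset n) (f : Fin n → Fin n → Fin n → Fin n → ℤ) → Σ⁴ A f ≡ Σ⁴ A (λ i j k l → f i j l k)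
  Σ⁴-swap₃₄ A f = Σ∉-cong A (λ i _ → Σ³-swap₂₃ (A ⊕ i) (f i))

  -- Adjacent transpositions of the summation indices carry each of the four triples to the first
  -- one.
  Σ⁴-triples : (A : Subset n) (f : Fin n → Fin n → Fin n → ℤ) →
    Σ⁴ A (λ i j k l → f i j k + f i j l + f i k l + f j k l) ≡ + 4 * Σ⁴ A (λ i j k _ → f i j k)
  Σ⁴-triples A f = begin
    Σ⁴ A (λ i j k l → f i j k + f i j l + f i k l + f j k l)
      ≡⟨ trans (Σ⁴-+ A _ _) (cong (_+ s₄) (trans (Σ⁴-+ A _ _) (cong (_+ s₃) (Σ⁴-+ A _ _)))) ⟩
    s₁ + s₂ + s₃ + s₄
      ≡⟨ cong₂ _+_ (cong₂ _+_ (cong (λ x → s₁ + x) e₂) e₃) e₄ ⟩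
    s₁ + s₁ + s₁ + s₁
      ≡⟨ four s₁ ⟩
    + 4 * s₁ ∎
    where
    open ≡-Reasoning
    s₁ = Σ⁴ A (λ i j k _ → f i j k)
    s₂ = Σ⁴ A (λ i j _ l → f i j l)
    s₃ = Σ⁴ A (λ i _ k l → f i k l)
    s₄ = Σ⁴ A (λ _ j k l → f j k l)
    e₂ : s₂ ≡ s₁
    e₂ = Σ⁴-swap₃₄ A _
    e₃ : s₃ ≡ s₁
    e₃ = trans (Σ⁴-swap₂₃ A _) e₂
    e₄ : s₄ ≡ s₁
    e₄ = trans (Σ⁴-swap₁₂ A _) e₃
    four : ∀ x → x + x + x + x ≡ + 4 * x
    four = solve-∀

  Σ⁴-pairs : (A : Subset n) (f : Fin n → Fin n → Fin n → Fin n → ℤ) →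
    Σ⁴ A (λ i j k l → f i j k l + f i k j l + f i l j k + f j k i l + f j l i k + f k l i j) ≡ + 6 * Σ⁴ A f
  Σ⁴-pairs A f = begin
    Σ⁴ A (λ i j k l → f i j k l + f i k j l + f i l j k + f j k i l + f j l i k + f k l i j)
      ≡⟨ trans (Σ⁴-+ A _ _) (cong (_+ s₆) (trans (Σ⁴-+ A _ _) (cong (_+ s₅) (trans (Σ⁴-+ A _ _) (cong (_+ s₄)
           (trans (Σ⁴-+ A _ _) (cong (_+ s₃) (Σ⁴-+ A _ _)))))))) ⟩
    s₁ + s₂ + s₃ + s₄ + s₅ + s₆
      ≡⟨ cong₂ _+_ (cong₂ _+_ (cong₂ _+_ (cong₂ _+_ (cong (λ x → s₁ + x) e₂) e₃) e₄) e₅) e₆ ⟩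
    s₁ + s₁ + s₁ + s₁ + s₁ + s₁
      ≡⟨ six s₁ ⟩
    + 6 * s₁ ∎
    where
    open ≡-Reasoning
    s₁ = Σ⁴ A f
    s₂ = Σ⁴ A (λ i j k l → f i k j l)
    s₃ = Σ⁴ A (λ i j k l → f i l j k)
    s₄ = Σ⁴ A (λ i j k l → f j k i l)
    s₅ = Σ⁴ A (λ i j k l → f j l i k)
    s₆ = Σ⁴ A (λ i j k l → f k l i j)
    e₂ : s₂ ≡ s₁
    e₂ = Σ⁴-swap₂₃ A _
    e₃ : s₃ ≡ s₁
    e₃ = trans (Σ⁴-swap₃₄ A _) e₂
    e₄ : s₄ ≡ s₁
    e₄ = trans (Σ⁴-swap₁₂ A _) e₂
    e₅ : s₅ ≡ s₁
    e₅ = trans (Σ⁴-swap₁₂ A _) e₃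
    e₆ : s₆ ≡ s₁
    e₆ = trans (Σ⁴-swap₂₃ A _) e₅
    six : ∀ x → x + x + x + x + x + x ≡ + 6 * x
    six = solve-∀

  square≥0 : ∀ x → 0ℤ ≤ x * x
  square≥0 (+ m)          = ℤₚ.≤-trans (+≤+ ℕ.z≤n) (ℤₚ.≤-reflexive (ℤₚ.pos-* m m))
  square≥0 -[1+ m ] = +≤+ ℕ.z≤n

  -- Restoring the diagonal l = k turns the double sum into a square.
  Σ²-product : (B : Subset n) (f : Fin n → ℤ) → - Σ∉ B (λ k → f k * f k) ≤ Σ² B (λ k l → f k * f l)
  Σ²-product B f = begin
    - D                                     ≤⟨ add-nonNeg (square≥0 s) ⟩
    s * s + - D                             ≡⟨ cong (_+ - D) (sym total) ⟩
    (Σ² B (λ k l → f k * f l) + D) + - D    ≡⟨ cancel (Σ² B (λ k l → f k * f l)) D ⟩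
    Σ² B (λ k l → f k * f l)                ∎
    where
    add-nonNeg : ∀ {x y} → 0ℤ ≤ x → y ≤ x + y
    add-nonNeg {x} {y} p = ℤₚ.≤-trans (ℤₚ.≤-reflexive (sym (ℤₚ.+-identityˡ y))) (ℤₚ.+-monoˡ-≤ y p)
    open ℤₚ.≤-Reasoning
    s = Σ∉ B f
    D = Σ∉ B (λ k → f k * f k)
    cancel : ∀ x y → (x + y) + - y ≡ x
    cancel = solve-∀
    total : Σ² B (λ k l → f k * f l) + D ≡ s * s
    total = trans (sym (Σ∉-+ B _ _)) (trans (Σ∉-cong B term) (trans (Σ∉-cong B (λ k _ → ℤₚ.*-comm (f k) s)) (Σ∉-* B s f)))
      where
      term : ∀ k → lookup B k ≡ false → Σ∉ (B ⊕ k) (λ l → f k * f l) + f k * f k ≡ f k * s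
      term k k∉B = trans (cong (_+ f k * f k) (Σ∉-* (B ⊕ k) (f k) f))
        (trans (rearrange (f k) (Σ∉ (B ⊕ k) f)) (cong (f k *_) (sym (Σ∉-⊕ B k k∉B f))))
        where
        rearrange : ∀ x y → x * y + x * x ≡ x * (x + y)
        rearrange = solve-∀

  -- Indicators, strict inclusion and sums along maximal chains

  _≟ˢ_ : DecidableEquality (Subset n)
  _≟ˢ_ = ≡-dec _≟ᵇ_

  ⟦_⟧ : Bool → ℤ
  ⟦ true ⟧  = 1ℤ
  ⟦ false ⟧ = 0ℤ

  ⟦⟧≥0 : ∀ b → 0ℤ ≤ ⟦ b ⟧
  ⟦⟧≥0 true  = +≤+ ℕ.z≤n
  ⟦⟧≥0 false = ℤₚ.≤-refl

  ⟦⟧≤1 : ∀ b → ⟦ b ⟧ ≤ 1ℤ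
  ⟦⟧≤1 true  = ℤₚ.≤-refl
  ⟦⟧≤1 false = +≤+ ℕ.z≤n

  ⊆-lookup : {S T : Subset n} → (∀ i → lookup S i ≡ true → lookup T i ≡ true) → S ⊆ T
  ⊆-lookup {S = S} {T} p {i} i∈S = lookup⇒[]= i T (p i ([]=⇒lookup i∈S))

  ⊂-⊕ : (S : Subset n) (i : Fin n) → lookup S i ≡ false → S ⊂ S ⊕ i
  ⊂-⊕ S i p = ⊆-lookup (λ j → lookup-⊕-mono S i j) , i , lookup⇒[]= i (S ⊕ i) (lookup∘update i S true) ,
    λ i∈S → absurd (trans (sym ([]=⇒lookup i∈S)) p)
    where
    absurd : true ≢ false
    absurd ()

  ⊂-⊕-trans : {T S : Subset n} (i : Fin n) → T ⊂ S → T ⊂ S ⊕ i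
  ⊂-⊕-trans {S = S} i T⊂S = ⊂-⊆-trans T⊂S (⊆-lookup (λ j → lookup-⊕-mono S i j))

  ⊆∧<⇒⊂ : {S T : Subset n} → S ⊆ T → ∣ S ∣ ℕ.< ∣ T ∣ → S ⊂ T
  ⊆∧<⇒⊂ {S = []} {[]} _ ()
  ⊆∧<⇒⊂ {S = true  ∷ S} {true  ∷ T} p (ℕ.s≤s q) = in⊂in (⊆∧<⇒⊂ (drop-∷-⊆ p) q)
  ⊆∧<⇒⊂ {S = true  ∷ S} {false ∷ T} p q with p here
  ... | ()
  ⊆∧<⇒⊂ {S = false ∷ S} {true  ∷ T} p q = out⊂in (drop-∷-⊆ p)
  ⊆∧<⇒⊂ {S = false ∷ S} {false ∷ T} p q = out⊂ (⊆∧<⇒⊂ (drop-∷-⊆ p) q)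

  lookup-⊝-self : (S : Subset n) (i : Fin n) → lookup (S ⊝ i) i ≡ false
  lookup-⊝-self S i = lookup∘update i S false

  ⊝-⊂ : (S : Subset n) (i : Fin n) → lookup S i ≡ true → S ⊝ i ⊂ S
  ⊝-⊂ S i p = subst (S ⊝ i ⊂_) (⊝-⊕ S i p) (⊂-⊕ (S ⊝ i) i (lookup-⊝-self S i))

  ∣⊝∣ : (S : Subset n) (i : Fin n) → lookup S i ≡ true → suc ∣ S ⊝ i ∣ ≡ ∣ S ∣
  ∣⊝∣ S i p = trans (sym (∣⊕∣ (S ⊝ i) i (lookup-⊝-self S i))) (cong ∣_∣ (⊝-⊕ S i p))

  size-⊕ : ∀ {r} (S : Subset n) i → lookup S i ≡ false → ∣ S ∣ ℕ.+ suc r ≡ n → ∣ S ⊕ i ∣ ℕ.+ r ≡ n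
  size-⊕ {r = r} S i p e = trans (cong (ℕ._+ r) (∣⊕∣ S i p)) (trans (sym (ℕₚ.+-suc ∣ S ∣ r)) e)

  -- H χ r S is the sum, over the r ! maximal chains from S upwards (where n = ∣ S ∣ + r),
  -- of the values of χ along the chain.
  H : (Subset n → ℤ) → ℕ → Subset n → ℤ
  H χ zero    S = χ S
  H χ (suc r) S = + (suc r !) * χ S + Σ∉ S (λ i → H χ r (S ⊕ i))

  *-nonNeg : ∀ m {x} → 0ℤ ≤ x → 0ℤ ≤ + m * x
  *-nonNeg m p = ℤₚ.≤-trans (ℤₚ.≤-reflexive (sym (ℤₚ.*-zeroʳ (+ m)))) (ℤₚ.*-monoˡ-≤-nonNeg (+ m) p)

  H-mono : ∀ {χ χ′ : Subset n → ℤ} r S → (∀ T → χ T ≤ χ′ T) → H χ r S ≤ H χ′ r S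
  H-mono zero    S p = p S
  H-mono (suc r) S p = ℤₚ.+-mono-≤ (ℤₚ.*-monoˡ-≤-nonNeg (+ (suc r !)) (p S))
    (Σ∉-mono S (λ i _ → H-mono r (S ⊕ i) p))

  H-+ : ∀ (χ χ′ : Subset n → ℤ) r S → H (λ T → χ T + χ′ T) r S ≡ H χ r S + H χ′ r S
  H-+ χ χ′ zero    S = refl
  H-+ χ χ′ (suc r) S = trans
    (cong (λ x → + (suc r !) * (χ S + χ′ S) + x)
      (trans (Σ∉-cong S (λ i _ → H-+ χ χ′ r (S ⊕ i))) (Σ∉-+ S _ _)))
    (rearrange (+ (suc r !)) (χ S) (χ′ S) _ _)
    where
    rearrange : ∀ c x y a b → c * (x + y) + (a + b) ≡ (c * x + a) + (c * y + b)
    rearrange = solve-∀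

  H-nonNeg : ∀ {χ : Subset n → ℤ} r S → (∀ T → 0ℤ ≤ χ T) → 0ℤ ≤ H χ r S
  H-nonNeg zero    S p = p S
  H-nonNeg (suc r) S p = ℤₚ.+-mono-≤ (*-nonNeg (suc r !) (p S)) (Σ∉-nonNeg S (λ i _ → H-nonNeg r (S ⊕ i) p))

  -- Membership patterns on four points and the finite certificate

  mem : List (Subset n) → Subset n → Bool
  mem F S = does (any? (S ≟ˢ_) F)

  χ[_] : List (Subset n) → Subset n → ℤ
  χ[ F ] S = ⟦ mem F S ⟧

  mem-true : {F : List (Subset n)} {S : Subset n} → S ∈ F → mem F S ≡ true
  mem-true {F = F} {S} S∈F = dec-true (any? (S ≟ˢ_) F) S∈F

  mem-true⁻ : (F : List (Subset n)) (S : Subset n) → mem F S ≡ true → S ∈ F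
  mem-true⁻ F S p with any? (S ≟ˢ_) F
  ... | yes q = q

  -- A vertex i of the link of A carries the bit a i = [A + i ∈ F], and a pair i j the bit
  -- e i j = [A + i + j ∈ F].

  ♯ : Bool → ℕ
  ♯ true  = 1
  ♯ false = 0

  -- Six times the excess of a triple with q bits set: a third of the chains below it hit each of the
  -- corresponding members, and above it one further hit is possible if q = 1 and none if q ≥ 2.
  weight : ℕ → ℤ
  weight 0 = 0ℤ
  weight 1 = + 2
  weight q = + 2 * + q - + 6

  -- Nested to the right with a final 0, as `count` unfolds on the six sets of `sets`, so that
  -- `q i j k` is a value of `triple` by definition.
  triple : (a₁ a₂ a₃ e₁₂ e₁₃ e₂₃ : Bool) → ℕ
  triple a₁ a₂ a₃ e₁₂ e₁₃ e₂₃ = ♯ a₁ ℕ.+ (♯ a₂ ℕ.+ (♯ a₃ ℕ.+ (♯ e₁₂ ℕ.+ (♯ e₁₃ ℕ.+ (♯ e₂₃ ℕ.+ 0)))))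

  -- Two singletons count as linked so that in the second extremal configuration described below
  -- every pair is linked and only the marks on vertices tell the halves apart.
  link : (a₁ a₂ e₁₂ : Bool) → Bool
  link a₁ a₂ e₁₂ = e₁₂ ∨ (a₁ ∧ a₂)

  -- For a pair i j, the sum of its flags over k vanishes in both extremal configurations: no singletons
  -- and the pairs inside two halves of the ground set; or the singletons of one half and all pairs not
  -- inside that half.
  flag : (aₖ ij ik jk : Bool) → ℤ
  flag aₖ    false ik    jk    = ⟦ jk ⟧ - ⟦ ik ⟧
  flag aₖ    true  false false = - 1ℤ
  flag false true  true  true  = 1ℤ
  flag true  true  true  true  = - 1ℤ
  flag aₖ    true  _     _     = 0ℤ

  Flag : (a₁ a₂ a₃ e₁₂ e₁₃ e₂₃ : Bool) → ℤ
  Flag a₁ a₂ a₃ e₁₂ e₁₃ e₂₃ = flag a₃ (link a₁ a₂ e₁₂) (link a₁ a₃ e₁₃) (link a₂ a₃ e₂₃)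

  isZero : ℕ → Bool
  isZero zero    = true
  isZero (suc _) = false

  -- Three true bits would give the diamond A, A + i, A + j, A + i + j.
  compatible : (a₁ a₂ e₁₂ : Bool) → Bool
  compatible a₁ a₂ e₁₂ = not (a₁ ∧ a₂ ∧ e₁₂)

  -- The scale is 24 times the excess. Each of the four triples carries six times its own excess, a
  -- quarter of the density of empty quadruples becomes the coefficient 6, and the target 1/4
  -- becomes the constant 6 in `check`. In `products` each of the six pairs multiplies its flags at
  -- the two remaining points. The flag of an unlinked pair changes sign when the pair is reversed,
  -- but the product does not.
  module Quadruple (a₁ a₂ a₃ a₄ e₁₂ e₁₃ e₁₄ e₂₃ e₂₄ e₃₄ : Bool) where
    q₁₂₃ q₁₂₄ q₁₃₄ q₂₃₄ : ℕ
    q₁₂₃ = triple a₁ a₂ a₃ e₁₂ e₁₃ e₂₃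
    q₁₂₄ = triple a₁ a₂ a₄ e₁₂ e₁₄ e₂₄
    q₁₃₄ = triple a₁ a₃ a₄ e₁₃ e₁₄ e₃₄
    q₂₃₄ = triple a₂ a₃ a₄ e₂₃ e₂₄ e₃₄

    weights : ℤ
    weights = (weight q₁₂₃ + weight q₁₂₄ + weight q₁₃₄ + weight q₂₃₄)
      + + 6 * ⟦ isZero q₁₂₃ ∧ isZero q₁₂₄ ∧ isZero q₁₃₄ ∧ isZero q₂₃₄ ⟧

    products : ℤ
    products =
        Flag a₁ a₂ a₃ e₁₂ e₁₃ e₂₃ * Flag a₁ a₂ a₄ e₁₂ e₁₄ e₂₄
      + Flag a₁ a₃ a₂ e₁₃ e₁₂ e₂₃ * Flag a₁ a₃ a₄ e₁₃ e₁₄ e₃₄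
      + Flag a₁ a₄ a₂ e₁₄ e₁₂ e₂₄ * Flag a₁ a₄ a₃ e₁₄ e₁₃ e₃₄
      + Flag a₂ a₃ a₁ e₂₃ e₁₂ e₁₃ * Flag a₂ a₃ a₄ e₂₃ e₂₄ e₃₄
      + Flag a₂ a₄ a₁ e₂₄ e₁₂ e₁₄ * Flag a₂ a₄ a₃ e₂₄ e₂₃ e₃₄
      + Flag a₃ a₄ a₁ e₃₄ e₁₃ e₁₄ * Flag a₃ a₄ a₂ e₃₄ e₂₃ e₂₄

    allCompatible : Bool
    allCompatible = compatible a₁ a₂ e₁₂ ∧ compatible a₁ a₃ e₁₃ ∧ compatible a₁ a₄ e₁₄ ∧
      compatible a₂ a₃ e₂₃ ∧ compatible a₂ a₄ e₂₄ ∧ compatible a₃ a₄ e₃₄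

    check : Bool
    check = if allCompatible then weights ≤ᵇ + 6 - products else true

  everywhere : ∀ k → (Vec Bool k → Bool) → Bool
  everywhere zero    P = P []
  everywhere (suc k) P = everywhere k (λ v → P (true ∷ v)) ∧ everywhere k (λ v → P (false ∷ v))

  ∧-true : ∀ {a b} → a ∧ b ≡ true → a ≡ true
  ∧-true {true} _ = refl

  ∧-true′ : ∀ {a b} → a ∧ b ≡ true → b ≡ true
  ∧-true′ {true} p = p

  everywhere-sound : ∀ k (P : Vec Bool k → Bool) → everywhere k P ≡ true → ∀ v → P v ≡ true
  everywhere-sound zero    P p []          = p
  everywhere-sound (suc k) P p (true  ∷ v) = everywhere-sound k _ (∧-true p) v
  everywhere-sound (suc k) P p (false ∷ v) = everywhere-sound k _ (∧-true′ p) v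

  checkVec : Vec Bool 10 → Bool
  checkVec (a₁ ∷ a₂ ∷ a₃ ∷ a₄ ∷ e₁₂ ∷ e₁₃ ∷ e₁₄ ∷ e₂₃ ∷ e₂₄ ∷ e₃₄ ∷ []) =
    Quadruple.check a₁ a₂ a₃ a₄ e₁₂ e₁₃ e₁₄ e₂₃ e₂₄ e₃₄

  check-everywhere : everywhere 10 checkVec ≡ true
  check-everywhere = refl

  -- The flag-algebra certificate, found by linear programming and checked on all 2 ^ 10 patterns: summed
  -- over the quadruples of distinct elements, the products form a sum of squares up to diagonal terms.
  quadruple-bound : ∀ a₁ a₂ a₃ a₄ e₁₂ e₁₃ e₁₄ e₂₃ e₂₄ e₃₄ →
    let open Quadruple a₁ a₂ a₃ a₄ e₁₂ e₁₃ e₁₄ e₂₃ e₂₄ e₃₄ in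
    allCompatible ≡ true → weights ≤ + 6 - products
  quadruple-bound a₁ a₂ a₃ a₄ e₁₂ e₁₃ e₁₄ e₂₃ e₂₄ e₃₄ ok
    with everywhere-sound 10 checkVec check-everywhere
           (a₁ ∷ a₂ ∷ a₃ ∷ a₄ ∷ e₁₂ ∷ e₁₃ ∷ e₁₄ ∷ e₂₃ ∷ e₂₄ ∷ e₃₄ ∷ [])
  ... | p rewrite ok = ℤₚ.≤ᵇ⇒≤ (subst IsTrue (sym p) tt)

  -- Chains above a fixed member A

  module Above {n : ℕ} (F : List (Subset n)) (diamondFree : DiamondFree F)
               (A : Subset n) (A∈F : A ∈ F) where

    χ : Subset n → ℤ
    χ = χ[ F ]

    h : ℕ → Subset n → ℤ
    h = H χ

    Between : Subset n → Subset n → Set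
    Between S t = t ∈ F × A ⊂ t × t ⊂ S

    member-cases : ∀ S → (S ∈ F × χ S ≡ 1ℤ) ⊎ χ S ≡ 0ℤ
    member-cases S with mem F S in eq
    ... | true  = inj₁ (mem-true⁻ F S eq , refl)
    ... | false = inj₂ refl

    Between-⊕ : ∀ {S t} i → Between S t → Between (S ⊕ i) t
    Between-⊕ i (t∈F , A⊂t , t⊂S) = t∈F , A⊂t , ⊂-⊕-trans i t⊂S

    -- A member containing S would strictly contain t and t′ and complete a diamond with A at the
    -- bottom, so no chain from S upwards hits anything.
    two-between : ∀ {t t′} r S → Between S t → Between S t′ → t ≢ t′ → h r S ≡ 0ℤ
    two-between r S b@(t∈F , A⊂t , t⊂S) b′@(t′∈F , A⊂t′ , t′⊂S) t≢t′ with member-cases S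
    ... | inj₁ (S∈F , _) = ⊥-elim (diamondFree
            (A , _ , _ , S , A∈F , t∈F , t′∈F , S∈F , A⊂t , t⊂S , A⊂t′ , t′⊂S , t≢t′))
    ... | inj₂ χ≡0 with r
    ...   | zero   = χ≡0
    ...   | suc r′ = cong₂ _+_ (trans (cong (+ (suc r′ !) *_) χ≡0) (ℤₚ.*-zeroʳ (+ (suc r′ !))))
            (trans (Σ∉-cong S (λ i _ → two-between r′ (S ⊕ i) (Between-⊕ i b) (Between-⊕ i b′) t≢t′)) (Σ∉-zero S))

    -- At the first member S met, t and S are two members strictly between A and every later set, so
    -- `two-between` rules out a second hit on each of the `r !` chains.
    one-between : ∀ {t} r S → ∣ S ∣ ℕ.+ r ≡ n → Between S t → h r S ≤ + (r !)
    one-between zero    S _ _ = ⟦⟧≤1 (mem F S)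
    one-between {t} (suc r) S e b@(_ , A⊂t , t⊂S) with member-cases S
    ... | inj₁ (S∈F , χ≡1) = ℤₚ.≤-reflexive (trans (cong₂ _+_
            (trans (cong (+ (suc r !) *_) χ≡1) (ℤₚ.*-identityʳ (+ (suc r !))))
            (trans (Σ∉-cong S (λ i p → two-between r (S ⊕ i) (Between-⊕ i b)
              (S∈F , ⊂-trans A⊂t t⊂S , ⊂-⊕ S i p) (λ t≡S → ⊂-irref t≡S t⊂S))) (Σ∉-zero S)))
            (ℤₚ.+-identityʳ (+ (suc r !))))
    ... | inj₂ χ≡0 = ℤₚ.≤-trans (ℤₚ.≤-reflexive (trans
            (cong (_+ Σ∉ S (λ i → h r (S ⊕ i))) (trans (cong (+ (suc r !) *_) χ≡0) (ℤₚ.*-zeroʳ (+ (suc r !)))))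
            (ℤₚ.+-identityˡ _)))
          (ℤₚ.≤-trans (Σ∉-mono S (λ i p → one-between r (S ⊕ i) (size-⊕ S i p e) (Between-⊕ i b)))
          (ℤₚ.≤-reflexive (trans (Σ∉-const S e (+ (r !))) (sym (ℤₚ.pos-* (suc r) (r !))))))

    -- Only k = 1 and k = 2 occur: k = 1 speaks of all members strictly between A and S, while k = 2
    -- exempts those one level below S.
    far? : ∀ k S t → Dec (A ⊂ t × t ⊂ S × k ℕ.+ ∣ t ∣ ℕ.≤ ∣ S ∣)
    far? k S t = (A ⊂? t) ×-dec (t ⊂? S) ×-dec (k ℕ.+ ∣ t ∣ ℕ.≤? ∣ S ∣)

    -- free k S says that no member t with A ⊂ t ⊂ S lies k or more levels below S.
    free : ℕ → Subset n → ℤ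
    free k S = ⟦ not (does (any? (far? k S) F)) ⟧

    free-cases : ∀ k S →
      (free k S ≡ 1ℤ × (∀ t → Between S t → k ℕ.+ ∣ t ∣ ℕ.≤ ∣ S ∣ → ⊥)) ⊎
      (free k S ≡ 0ℤ × ∃ λ t → Between S t × k ℕ.+ ∣ t ∣ ℕ.≤ ∣ S ∣)
    free-cases k S with any? (far? k S) F
    ... | no ¬p = inj₁ (refl , λ { t (t∈F , A⊂t , t⊂S) q → ¬p (lose t∈F (A⊂t , t⊂S , q)) })
    ... | yes p with find p
    ...   | t , t∈F , A⊂t , t⊂S , q = inj₂ (refl , t , (t∈F , A⊂t , t⊂S) , q)

    free≥0 : ∀ k S → 0ℤ ≤ free k S
    free≥0 k S = ⟦⟧≥0 _

    free₁≤free₂ : ∀ S → free 1 S ≤ free 2 S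
    free₁≤free₂ S with free-cases 2 S
    ... | inj₁ (e , _) = ℤₚ.≤-trans (⟦⟧≤1 _) (ℤₚ.≤-reflexive (sym e))
    ... | inj₂ (e , t , b , q) with free-cases 1 S
    ...   | inj₁ (_ , no-t) = ⊥-elim (no-t t b (ℕₚ.<⇒≤ q))
    ...   | inj₂ (e′ , _)   = ℤₚ.≤-reflexive (trans e′ (sym e))

    -- A member strictly between A and S lies at least two levels below `S ⊕ i`. Read backwards,
    -- `free 2` at R gives `free 1` at every `R ⊝ i` with i in R.
    free₂-⊕ : ∀ S i → lookup S i ≡ false → free 2 (S ⊕ i) ≤ free 1 S
    free₂-⊕ S i p with free-cases 1 S
    ... | inj₁ (e , _) = ℤₚ.≤-trans (⟦⟧≤1 _) (ℤₚ.≤-reflexive (sym e))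
    ... | inj₂ (e , t , b , q) with free-cases 2 (S ⊕ i)
    ...   | inj₁ (_ , no-t) = ⊥-elim (no-t t (Between-⊕ i b) (subst (2 ℕ.+ ∣ t ∣ ℕ.≤_) (sym (∣⊕∣ S i p)) (ℕ.s≤s q)))
    ...   | inj₂ (e′ , _)   = ℤₚ.≤-reflexive (trans e′ (sym e))

    between-cases : ∀ S t → (∃ λ t′ → Between S t′ × t′ ≢ t) ⊎ (∀ t′ → Between S t′ → t′ ≡ t)
    between-cases S t with any? (λ t′ → (A ⊂? t′) ×-dec (t′ ⊂? S) ×-dec ¬? (t′ ≟ˢ t)) F
    ... | yes p with find p
    ...   | t′ , t′∈F , A⊂t′ , t′⊂S , t′≢t = inj₁ (t′ , (t′∈F , A⊂t′ , t′⊂S) , t′≢t)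
    between-cases S t | no ¬p = inj₂ λ { t′ (t′∈F , A⊂t′ , t′⊂S) → unique t′ t′∈F A⊂t′ t′⊂S }
      where
      unique : ∀ t′ → t′ ∈ F → A ⊂ t′ → t′ ⊂ S → t′ ≡ t
      unique t′ t′∈F A⊂t′ t′⊂S with t′ ≟ˢ t
      ... | yes e = e
      ... | no ne = ⊥-elim (¬p (lose t′∈F (A⊂t′ , t′⊂S , ne)))

    -- The excess over one hit of the chains through S and S ⊕ l that meet no member between A and S.
    φ : ℕ → Subset n → Fin n → ℤ
    φ r S l = free 1 S * (+ (r !) * (χ S - 1ℤ) + h r (S ⊕ l))

    φ-value : ∀ r R i → lookup R i ≡ true → ∀ {z x y} →
      free 1 (R ⊝ i) ≡ z → χ (R ⊝ i) ≡ x → h r R ≡ y → φ r (R ⊝ i) i ≡ z * (+ (r !) * (x - 1ℤ) + y)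
    φ-value r R i i∈R refl refl refl =
      cong (λ T → free 1 (R ⊝ i) * (+ (r !) * (χ (R ⊝ i) - 1ℤ) + h r T)) (⊝-⊕ R i i∈R)

    free*-≤ : ∀ k S x m → x ≤ + m → free k S * x ≤ + m
    free*-≤ k S x m p with does (any? (far? k S) F)
    ... | false = ℤₚ.≤-trans (ℤₚ.≤-reflexive (ℤₚ.*-identityˡ x)) p
    ... | true  = +≤+ ℕ.z≤n

    -- If no member lies strictly between A and R, all s + 2 terms equal `h r R - r !`. If two do,
    -- `h r R` vanishes. If the only one is two or more levels below R, no `R ⊝ i` is a member and
    -- `one-between` makes every term nonpositive. If the only one is t, one level below R, a single
    -- order of removal reaches t and costs at most `r !`; this case is what `free 2 R - free 1 R`
    -- counts.
    Ψ-bound : ∀ {s} r R → Reach (suc (suc s)) A R → ∣ R ∣ ℕ.+ r ≡ n →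
      Ψ (φ r) A R ≤ + suc (suc s) * (free 1 R * (h r R - + (r !))) + + (r !) * (free 2 R - free 1 R)
    Ψ-bound {s} r R q e = cases
      where
      w : ℤ
      w = + (r !)

      RHS : ℤ → ℤ → ℤ
      RHS z j = + suc (suc s) * (z * (h r R - w)) + w * (j - z)

      -- R lies at least two levels above A so that `R ⊝ i` is still strictly above A.
      A⊂R⊝ : ∀ i → lookup A i ≡ false → lookup R i ≡ true → A ⊂ R ⊝ i
      A⊂R⊝ i i∉A i∈R = ⊆∧<⇒⊂ (⊆-lookup below)
        (ℕₚ.≤-trans (ℕ.s≤s (ℕₚ.m≤m+n ∣ A ∣ s))
          (ℕₚ.≤-reflexive (sym (ℕₚ.suc-injective (trans (∣⊝∣ R i i∈R)
            (trans (Reach-size q) (trans (ℕₚ.+-suc ∣ A ∣ (suc s)) (cong suc (ℕₚ.+-suc ∣ A ∣ s)))))))))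
        where
        below : ∀ j → lookup A j ≡ true → lookup (R ⊝ i) j ≡ true
        below j j∈A with j ≟ᶠ i
        ... | no j≢i = trans (lookup∘update′ j≢i R false) (Reach-lookup q j j∈A)
        ... | yes refl with trans (sym i∉A) j∈A
        ...   | ()

      Between-⊝ : ∀ i → lookup A i ≡ false → lookup R i ≡ true → R ⊝ i ∈ F → Between R (R ⊝ i)
      Between-⊝ i i∉A i∈R R⊝i∈F = R⊝i∈F , A⊂R⊝ i i∉A i∈R , ⊝-⊂ R i i∈R

      1+≤ : ∀ {t} → Between R t → suc ∣ t ∣ ℕ.≤ ∣ R ∣
      1+≤ (_ , _ , t⊂R) = p⊂q⇒∣p∣<∣q∣ t⊂R

      rhs≥0 : ∀ {z j} → free 1 R ≡ z → free 2 R ≡ j → z ≡ 0ℤ → 0ℤ ≤ j → 0ℤ ≤ RHS (free 1 R) (free 2 R)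
      rhs≥0 {z} {j} refl refl z≡0 0≤j = subst (λ z → 0ℤ ≤ RHS z j) (sym z≡0)
        (ℤₚ.≤-trans (*-nonNeg (r !) 0≤j) (ℤₚ.≤-reflexive (expand (+ suc (suc s)) w (h r R) j)))
        where
        expand : ∀ c w y j → w * j ≡ c * (0ℤ * (y - w)) + w * (j - 0ℤ)
        expand = solve-∀

      -w≤0 : ∀ x → x ≤ 1ℤ → w * (x - 1ℤ) ≤ 0ℤ
      -w≤0 x x≤1 = ℤₚ.≤-trans (ℤₚ.*-monoˡ-≤-nonNeg w (ℤₚ.i≤j⇒i-j≤0 x≤1)) (ℤₚ.≤-reflexive (ℤₚ.*-zeroʳ w))

      none : free 1 R ≡ 1ℤ → (∀ t → Between R t → 1 ℕ.+ ∣ t ∣ ℕ.≤ ∣ R ∣ → ⊥) →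
        Ψ (φ r) A R ≤ RHS (free 1 R) (free 2 R)
      none z≡1 no-t = ℤₚ.≤-reflexive (begin
        Ψ (φ r) A R                     ≡⟨ Ψ-cong (φ r) (λ _ _ → h r R - w) A R value ⟩
        Ψ (λ _ _ → h r R - w) A R       ≡⟨ Ψ-const (h r R - w) q ⟩
        + suc (suc s) * (h r R - w)     ≡⟨ expand (+ suc (suc s)) w (h r R) ⟩
        RHS 1ℤ 1ℤ                       ≡⟨ cong₂ RHS (sym z≡1) (sym j≡1) ⟩
        RHS (free 1 R) (free 2 R)       ∎)
        where
        open ≡-Reasoning
        expand : ∀ c w y → c * (y - w) ≡ c * (1ℤ * (y - w)) + w * (1ℤ - 1ℤ)
        expand = solve-∀
        j≡1 : free 2 R ≡ 1ℤ
        j≡1 = ℤₚ.≤-antisym (⟦⟧≤1 _) (ℤₚ.≤-trans (ℤₚ.≤-reflexive (sym z≡1)) (free₁≤free₂ R))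
        value : ∀ i → lookup A i ≡ false → lookup R i ≡ true → φ r (R ⊝ i) i ≡ h r R - w
        value i i∉A i∈R = trans (φ-value r R i i∈R z′≡1 χ≡0 refl) (simplify w (h r R))
          where
          simplify : ∀ w y → 1ℤ * (w * (0ℤ - 1ℤ) + y) ≡ y - w
          simplify = solve-∀
          χ≡0 : χ (R ⊝ i) ≡ 0ℤ
          χ≡0 with member-cases (R ⊝ i)
          ... | inj₂ p = p
          ... | inj₁ (R⊝i∈F , _) = ⊥-elim (no-t _ (Between-⊝ i i∉A i∈R R⊝i∈F) (1+≤ (Between-⊝ i i∉A i∈R R⊝i∈F)))
          z′≡1 : free 1 (R ⊝ i) ≡ 1ℤ
          z′≡1 = ℤₚ.≤-antisym (⟦⟧≤1 _) (ℤₚ.≤-trans (ℤₚ.≤-reflexive (sym j≡1))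
            (subst (λ T → free 2 T ≤ free 1 (R ⊝ i)) (⊝-⊕ R i i∈R) (free₂-⊕ (R ⊝ i) i (lookup-⊝-self R i))))

      two : ∀ {t t′} → Between R t → Between R t′ → t ≢ t′ → Ψ (φ r) A R ≤ 0ℤ
      two b b′ t≢t′ = Ψ-nonPos (φ r) A R (λ i i∉A i∈R →
        ℤₚ.≤-trans (ℤₚ.≤-reflexive (φ-value r R i i∈R refl refl (two-between r R b b′ t≢t′)))
        (free*-≤ 1 (R ⊝ i) (w * (χ (R ⊝ i) - 1ℤ) + 0ℤ) 0
          (ℤₚ.≤-trans (ℤₚ.≤-reflexive (ℤₚ.+-identityʳ _)) (-w≤0 (χ (R ⊝ i)) (⟦⟧≤1 _)))))

      nonmember : ∀ {t} → Between R t → ∀ i → lookup R i ≡ true → χ (R ⊝ i) ≡ 0ℤ → φ r (R ⊝ i) i ≤ 0ℤ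
      nonmember b i i∈R χ≡0 = ℤₚ.≤-trans (ℤₚ.≤-reflexive (φ-value r R i i∈R refl χ≡0 refl))
        (free*-≤ 1 (R ⊝ i) (w * (0ℤ - 1ℤ) + h r R) 0 (ℤₚ.≤-trans (ℤₚ.≤-reflexive (simplify w (h r R)))
          (ℤₚ.i≤j⇒i-j≤0 (one-between r R e b))))
        where
        simplify : ∀ w y → w * (0ℤ - 1ℤ) + y ≡ y - w
        simplify = solve-∀

      far : ∀ {t} → Between R t → 2 ℕ.+ ∣ t ∣ ℕ.≤ ∣ R ∣ → (∀ t′ → Between R t′ → t′ ≡ t) → Ψ (φ r) A R ≤ 0ℤ
      far {t} b 2+≤ unique = Ψ-nonPos (φ r) A R λ i i∉A i∈R → nonmember b i i∈R (χ≡0 i i∉A i∈R)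
        where
        χ≡0 : ∀ i → lookup A i ≡ false → lookup R i ≡ true → χ (R ⊝ i) ≡ 0ℤ
        χ≡0 i i∉A i∈R with member-cases (R ⊝ i)
        ... | inj₂ p = p
        ... | inj₁ (R⊝i∈F , _) = ⊥-elim (ℕₚ.<-irrefl
                (trans (cong suc (cong ∣_∣ (sym (unique _ (Between-⊝ i i∉A i∈R R⊝i∈F))))) (∣⊝∣ R i i∈R)) 2+≤)

      -- Here x is an element of R missing from t. For i ≠ x the set `R ⊝ i` contains x, hence is
      -- not t and not a member, so only the term at x can be positive.
      near : ∀ {t} → Between R t → (∀ t′ → Between R t′ → t′ ≡ t) → Ψ (φ r) A R ≤ w
      near {t} b@(_ , A⊂t , _ , x , x∈R , x∉t) unique = ℤₚ.≤-trans
        (ℤₚ.≤-reflexive (Ψ-⊕ (φ r) A R x x∉A ([]=⇒lookup x∈R)))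
        (ℤₚ.≤-trans (ℤₚ.+-mono-≤ top rest) (ℤₚ.≤-reflexive (ℤₚ.+-identityʳ w)))
        where
        x∉A : lookup A x ≡ false
        x∉A with lookup A x in eq
        ... | false = refl
        ... | true  = ⊥-elim (x∉t (proj₁ A⊂t (lookup⇒[]= x A eq)))

        top : φ r (R ⊝ x) x ≤ w
        top = ℤₚ.≤-trans (ℤₚ.≤-reflexive (φ-value r R x ([]=⇒lookup x∈R) refl refl refl))
          (free*-≤ 1 (R ⊝ x) (w * (χ (R ⊝ x) - 1ℤ) + h r R) (r !)
            (ℤₚ.≤-trans (ℤₚ.+-mono-≤ (-w≤0 (χ (R ⊝ x)) (⟦⟧≤1 _)) (one-between r R e b))
            (ℤₚ.≤-reflexive (ℤₚ.+-identityˡ w))))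

        rest : Ψ (φ r) (A ⊕ x) R ≤ 0ℤ
        rest = Ψ-nonPos (φ r) (A ⊕ x) R λ i i∉ i∈R → nonmember b i i∈R (χ≡0 i i∉ i∈R)
          where
          χ≡0 : ∀ i → lookup (A ⊕ x) i ≡ false → lookup R i ≡ true → χ (R ⊝ i) ≡ 0ℤ
          χ≡0 i i∉ i∈R with member-cases (R ⊝ i)
          ... | inj₂ p = p
          ... | inj₁ (R⊝i∈F , _) = ⊥-elim (x∉t (subst (x ∈ˢ_)
                  (unique _ (Between-⊝ i (lookup-⊕⁻ A x i i∉) i∈R R⊝i∈F))
                  (lookup⇒[]= x (R ⊝ i) (trans (lookup∘update′ (∉⊕⇒≢ A x i i∉) R false) ([]=⇒lookup x∈R)))))

      cases : Ψ (φ r) A R ≤ RHS (free 1 R) (free 2 R)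
      cases with free-cases 1 R
      ... | inj₁ (z≡1 , no-t) = none z≡1 no-t
      ... | inj₂ (z≡0 , t , b , _) with between-cases R t
      ...   | inj₁ (t′ , b′ , t′≢t) = ℤₚ.≤-trans (two b′ b t′≢t) (rhs≥0 refl refl z≡0 (free≥0 2 R))
      ...   | inj₂ unique with free-cases 2 R
      ...     | inj₂ (_ , t′ , b′ , 2+≤) = ℤₚ.≤-trans
                (far b′ 2+≤ (λ t″ b″ → trans (unique t″ b″) (sym (unique t′ b′))))
                (rhs≥0 refl refl z≡0 (free≥0 2 R))
      ...     | inj₁ (j≡1 , _) = ℤₚ.≤-trans (near b unique) (ℤₚ.≤-reflexive
                (trans (expand (+ suc (suc s)) w (h r R)) (cong₂ RHS (sym z≡0) (sym j≡1))))
        where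
        expand : ∀ c w y → w ≡ c * (0ℤ * (y - w)) + w * (1ℤ - 0ℤ)
        expand = solve-∀

    -- Counted over the chains that meet no member strictly between A and level s, the hits from level s
    -- on, less one per chain.
    excess : ℕ → ℕ → ℤ
    excess s r = U s (λ S → free 1 S * (h r S - + (r !))) A

    -- The chains through S are first distributed over the next element l, which turns the summand
    -- into a sum of `φ r S l`; then `U-symmetrise` averages over which of the s + 1 elements came
    -- last.
    excess-symmetrised : ∀ s r → ∣ A ∣ ℕ.+ s ℕ.+ suc r ≡ n → + suc s * excess s (suc r) ≡ U (suc s) (Ψ (φ r) A) A
    excess-symmetrised s r e = trans (cong (+ suc s *_) (U-cong s A value)) (U-symmetrise s (φ r) A)
      where
      value : ∀ S → Reach s A S → free 1 S * (h (suc r) S - + (suc r !)) ≡ Σ∉ S (φ r S)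
      value S q = sym (begin
        Σ∉ S (φ r S)
          ≡⟨ Σ∉-* S (free 1 S) _ ⟩
        free 1 S * Σ∉ S (λ l → + (r !) * (χ S - 1ℤ) + h r (S ⊕ l))
          ≡⟨ cong (free 1 S *_) (trans (Σ∉-+ S (λ _ → c) _) (cong (_+ Σ∉ S (λ l → h r (S ⊕ l)))
               (Σ∉-const S (trans (cong (ℕ._+ suc r) (Reach-size q)) e) c))) ⟩
        free 1 S * (+ suc r * (+ (r !) * (χ S - 1ℤ)) + Σ∉ S (λ l → h r (S ⊕ l)))
          ≡⟨ cong (free 1 S *_) (rearrange (+ suc r) (+ (r !)) (χ S) _) ⟩
        free 1 S * ((+ suc r * + (r !)) * χ S + Σ∉ S (λ l → h r (S ⊕ l)) - + suc r * + (r !))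
          ≡⟨ cong (λ w → free 1 S * (w * χ S + Σ∉ S (λ l → h r (S ⊕ l)) - w)) (sym (ℤₚ.pos-* (suc r) (r !))) ⟩
        free 1 S * (h (suc r) S - + (suc r !)) ∎)
        where
        open ≡-Reasoning
        c : ℤ
        c = + (r !) * (χ S - 1ℤ)
        rearrange : ∀ a b x y → a * (b * (x - 1ℤ)) + y ≡ (a * b) * x + y - a * b
        rearrange = solve-∀

    -- Induction on r, the number of levels left above s: `excess-step` obtains (s, r + 1) from (s +
    -- 1, r), and `free₂-⊕` turns its right side into the one stated here.
    excess-bound : ∀ r s → 3 ℕ.≤ s → ∣ A ∣ ℕ.+ s ℕ.+ r ≡ n → + 4 * excess s r ≤ + (r !) * U s (free 1) A
    -- The sharper form, measured one level higher: for s = 3 its right side is a sum over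
    -- quadruples, as the certificate requires.
    excess-step  : ∀ r s → 3 ℕ.≤ s → ∣ A ∣ ℕ.+ s ℕ.+ suc r ≡ n →
      + 4 * excess s (suc r) ≤ + (r !) * U (suc s) (free 2) A

    excess-step r s@(suc (suc (suc s′))) 3≤s e = ℤₚ.*-cancelˡ-≤-pos _ _ (+ suc s) (begin
      + suc s * (+ 4 * excess s (suc r))
        ≡⟨ swap (+ suc s) (+ 4) (excess s (suc r)) ⟩
      + 4 * (+ suc s * excess s (suc r))
        ≡⟨ cong (+ 4 *_) (excess-symmetrised s r e) ⟩
      + 4 * U (suc s) (Ψ (φ r) A) A
        ≤⟨ ℤₚ.*-monoˡ-≤-nonNeg (+ 4) (U-mono (suc s) A (λ R q → Ψ-bound r R q
             (trans (cong (ℕ._+ r) (trans (Reach-size q) (ℕₚ.+-suc ∣ A ∣ s)))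
                    (trans (sym (ℕₚ.+-suc (∣ A ∣ ℕ.+ s) r)) e)))) ⟩
      + 4 * U (suc s) (λ R → + suc s * (free 1 R * (h r R - w)) + w * (free 2 R - free 1 R)) A
        ≡⟨ cong (+ 4 *_) (trans (U-+ (suc s) _ _ A) (cong₂ _+_ (U-* (suc s) (+ suc s) _ A) (U-* (suc s) w _ A))) ⟩
      + 4 * (+ suc s * excess (suc s) r + w * D)
        ≡⟨ distribute (+ 4) (+ suc s) (excess (suc s) r) (w * D) ⟩
      + suc s * (+ 4 * excess (suc s) r) + + 4 * (w * D)
        ≤⟨ ℤₚ.+-mono-≤ (ℤₚ.*-monoˡ-≤-nonNeg (+ suc s) (excess-bound r (suc s) (ℕ.s≤s (ℕ.s≤s (ℕ.s≤s ℕ.z≤n)))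
             (trans (cong (ℕ._+ r) (ℕₚ.+-suc ∣ A ∣ s)) (trans (sym (ℕₚ.+-suc (∣ A ∣ ℕ.+ s) r)) e))))
           (scale (w * D) (*-nonNeg (r !) D≥0)) ⟩
      + suc s * (w * U (suc s) (free 1) A) + + suc s * (w * D)
        ≡⟨ collect (+ suc s) w (U (suc s) (free 1) A) D ⟩
      + suc s * (w * (U (suc s) (free 1) A + D))
        ≡⟨ cong (λ x → + suc s * (w * x)) (trans (sym (U-+ (suc s) _ _ A)) (U-cong (suc s) A (λ R _ → cancel (free 1 R) (free 2 R)))) ⟩
      + suc s * (w * U (suc s) (free 2) A) ∎)
      where
      open ℤₚ.≤-Reasoning
      w D : ℤ
      w = + (r !)
      D = U (suc s) (λ R → free 2 R - free 1 R) A
      D≥0 : 0ℤ ≤ D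
      D≥0 = ℤₚ.≤-trans (ℤₚ.≤-reflexive (sym (U-* (suc s) 0ℤ (λ _ → 0ℤ) A)))
        (U-mono (suc s) A (λ R _ → ℤₚ.i≤j⇒0≤j-i (free₁≤free₂ R)))
      -- The factor 1/4 arises here: a unique member one level below R is reached through only one
      -- of the s + 1 possible last elements, and s + 1 ≥ 4.
      scale : ∀ x → 0ℤ ≤ x → + 4 * x ≤ + suc s * x
      scale (+ x) _ = ℤₚ.*-monoʳ-≤-nonNeg (+ x) (+≤+ (ℕₚ.m≤m+n 4 s′))
      swap : ∀ a b x → a * (b * x) ≡ b * (a * x)
      swap = solve-∀
      distribute : ∀ a b x y → a * (b * x + y) ≡ b * (a * x) + a * y
      distribute = solve-∀
      collect : ∀ a w x y → a * (w * x) + a * (w * y) ≡ a * (w * (x + y))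
      collect = solve-∀
      cancel : ∀ x y → x + (y - x) ≡ y
      cancel = solve-∀
    excess-step r zero ()
    excess-step r (suc zero) (ℕ.s≤s ())
    excess-step r (suc (suc zero)) (ℕ.s≤s (ℕ.s≤s ()))

    excess-bound zero s _ _ = begin
      + 4 * excess s zero                 ≡⟨ sym (U-* s (+ 4) _ A) ⟩
      U s (λ S → + 4 * (free 1 S * (χ S - 1ℤ))) A
        ≤⟨ U-mono s A (λ S _ → ℤₚ.≤-trans
             (ℤₚ.≤-trans (ℤₚ.*-monoˡ-≤-nonNeg (+ 4) (free*-≤ 1 S (χ S - 1ℤ) 0 (ℤₚ.i≤j⇒i-j≤0 (⟦⟧≤1 (mem F S)))))
               (ℤₚ.≤-reflexive (ℤₚ.*-zeroʳ (+ 4))))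
             (free≥0 1 S)) ⟩
      U s (free 1) A                      ≡⟨ sym (ℤₚ.*-identityˡ _) ⟩
      1ℤ * U s (free 1) A                 ∎
      where open ℤₚ.≤-Reasoning
    excess-bound (suc r) s 3≤s e = begin
      + 4 * excess s (suc r)              ≤⟨ excess-step r s 3≤s e ⟩
      + (r !) * U (suc s) (free 2) A      ≡⟨ cong (+ (r !) *_) (U-last s (free 2) A) ⟩
      + (r !) * U s (λ S → Σ∉ S (λ i → free 2 (S ⊕ i))) A
        ≤⟨ ℤₚ.*-monoˡ-≤-nonNeg (+ (r !)) (U-mono s A (λ S q → ℤₚ.≤-trans
             (Σ∉-mono S (λ i p → free₂-⊕ S i p))
             (ℤₚ.≤-reflexive (Σ∉-const S (trans (cong (ℕ._+ suc r) (Reach-size q)) e) (free 1 S))))) ⟩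
      + (r !) * U s (λ S → + suc r * free 1 S) A
        ≡⟨ cong (+ (r !) *_) (U-* s (+ suc r) (free 1) A) ⟩
      + (r !) * (+ suc r * U s (free 1) A)
        ≡⟨ rearrange (+ (r !)) (+ suc r) (U s (free 1) A) ⟩
      (+ suc r * + (r !)) * U s (free 1) A
        ≡⟨ cong (_* U s (free 1) A) (sym (ℤₚ.pos-* (suc r) (r !))) ⟩
      + (suc r !) * U s (free 1) A        ∎
      where
      open ℤₚ.≤-Reasoning
      rearrange : ∀ a b x → a * (b * x) ≡ (b * a) * x
      rearrange = solve-∀

  -- Averaging over the triples and quadruples above A

  ∉-⊕ : (S : Subset n) {x y : Fin n} → lookup S y ≡ false → x ≢ y → lookup (S ⊕ x) y ≡ false
  ∉-⊕ S y∉S x≢y = trans (lookup∘update′ (≢-sym x≢y) S true) y∉S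

  ∈-⊕ : (S : Subset n) (x : Fin n) → lookup (S ⊕ x) x ≡ true
  ∈-⊕ S x = lookup∘update x S true

  differ : {S T : Subset n} (x : Fin n) → lookup S x ≡ true → lookup T x ≡ false → S ≢ T
  differ x x∈S x∉T refl with trans (sym x∈S) x∉T
  ... | ()

  -- Nested sums supply freshness in one order of the indices; this symmetric form serves all
  -- orders.
  record Fresh {n : ℕ} (A : Subset n) (i j k : Fin n) : Set where
    constructor fresh
    field
      i∉ : lookup A i ≡ false
      j∉ : lookup A j ≡ false
      k∉ : lookup A k ≡ false
      i≢j : i ≢ j
      i≢k : i ≢ k
      j≢k : j ≢ k

  toFresh : (A : Subset n) (i j k : Fin n) → lookup A i ≡ false → lookup (A ⊕ i) j ≡ false →
    lookup (A ⊕ i ⊕ j) k ≡ false → Fresh A i j k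
  toFresh A i j k i∉ j∉ k∉ = fresh i∉ (lookup-⊕⁻ A i j j∉) (lookup-⊕⁻ A i k k∉′)
    (∉⊕⇒≢ A i j j∉) (∉⊕⇒≢ A i k k∉′) (∉⊕⇒≢ (A ⊕ i) j k k∉)
    where
    k∉′ : lookup (A ⊕ i) k ≡ false
    k∉′ = lookup-⊕⁻ (A ⊕ i) j k k∉

  -- With n - ∣ A ∣ = 4 + p there are p + 1 levels above a triple and p above a quadruple.
  module Link {n : ℕ} (F : List (Subset n)) (diamondFree : DiamondFree F)
              (A : Subset n) (A∈F : A ∈ F) (p : ℕ) (size : ∣ A ∣ ℕ.+ (4 ℕ.+ p) ≡ n) where
    open Above F diamondFree A A∈F

    a : Fin n → Bool
    a i = mem F (A ⊕ i)

    e : Fin n → Fin n → Bool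
    e i j = mem F (A ⊕ i ⊕ j)

    e-sym : ∀ i j → e i j ≡ e j i
    e-sym i j = cong (mem F) (⊕-comm A i j)

    sets : Fin n → Fin n → Fin n → List (Subset n)
    sets i j k = A ⊕ i ∷ A ⊕ j ∷ A ⊕ k ∷ A ⊕ i ⊕ j ∷ A ⊕ i ⊕ k ∷ A ⊕ j ⊕ k ∷ []

    count : List (Subset n) → ℕ
    count []       = 0
    count (t ∷ ts) = ♯ (mem F t) ℕ.+ count ts

    q : Fin n → Fin n → Fin n → ℕ
    q i j k = count (sets i j k)

    count-pos : ∀ ts → 1 ℕ.≤ count ts → ∃ λ t → t ∈ ts × t ∈ F
    count-pos (t ∷ ts) 1≤ with mem F t in eq
    ... | true = t , here refl , mem-true⁻ F t eq
    ... | false with count-pos ts 1≤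
    ...   | t′ , t′∈ts , t′∈F = t′ , there t′∈ts , t′∈F

    count-two : ∀ ts → Unique ts → 2 ℕ.≤ count ts →
      ∃ λ t → ∃ λ t′ → t ∈ ts × t′ ∈ ts × t ∈ F × t′ ∈ F × t ≢ t′
    count-two (t ∷ ts) (t≢ts ∷ u) 2≤ with mem F t in eq
    ... | true with count-pos ts (ℕ.s≤s⁻¹ 2≤)
    ...   | t′ , t′∈ts , t′∈F =
              t , t′ , here refl , there t′∈ts , mem-true⁻ F t eq , t′∈F , All.lookup t≢ts t′∈ts
    count-two (t ∷ ts) (t≢ts ∷ u) 2≤ | false with count-two ts u 2≤
    ...   | t′ , t″ , t′∈ , t″∈ , rest = t′ , t″ , there t′∈ , there t″∈ , rest

    module _ {i j k : Fin n} (f : Fresh A i j k) where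
      open Fresh f

      sets-unique : Unique (sets i j k)
      sets-unique =
          (differ i (∈-⊕ A i) (∉-⊕ A i∉ (≢-sym i≢j))
          ∷ differ i (∈-⊕ A i) (∉-⊕ A i∉ (≢-sym i≢k))
          ∷ ≢-sym (differ j (∈-⊕ (A ⊕ i) j) (∉-⊕ A j∉ i≢j))
          ∷ ≢-sym (differ k (∈-⊕ (A ⊕ i) k) (∉-⊕ A k∉ i≢k))
          ∷ differ i (∈-⊕ A i) (∉-⊕ (A ⊕ j) (∉-⊕ A i∉ (≢-sym i≢j)) (≢-sym i≢k)) ∷ [])
        ∷ (differ j (∈-⊕ A j) (∉-⊕ A j∉ (≢-sym j≢k))
          ∷ ≢-sym (differ i (lookup-⊕-mono (A ⊕ i) j i (∈-⊕ A i)) (∉-⊕ A i∉ (≢-sym i≢j)))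
          ∷ ≢-sym (differ k (∈-⊕ (A ⊕ i) k) (∉-⊕ A k∉ j≢k))
          ∷ ≢-sym (differ k (∈-⊕ (A ⊕ j) k) (∉-⊕ A k∉ j≢k)) ∷ [])
        ∷ (≢-sym (differ i (lookup-⊕-mono (A ⊕ i) j i (∈-⊕ A i)) (∉-⊕ A i∉ (≢-sym i≢k)))
          ∷ ≢-sym (differ i (lookup-⊕-mono (A ⊕ i) k i (∈-⊕ A i)) (∉-⊕ A i∉ (≢-sym i≢k)))
          ∷ ≢-sym (differ j (lookup-⊕-mono (A ⊕ j) k j (∈-⊕ A j)) (∉-⊕ A j∉ (≢-sym j≢k))) ∷ [])
        ∷ (differ j (∈-⊕ (A ⊕ i) j) (∉-⊕ (A ⊕ i) (∉-⊕ A j∉ i≢j) (≢-sym j≢k))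
          ∷ differ i (lookup-⊕-mono (A ⊕ i) j i (∈-⊕ A i)) i∉jk ∷ [])
        ∷ (differ i (lookup-⊕-mono (A ⊕ i) k i (∈-⊕ A i)) i∉jk ∷ [])
        ∷ [] ∷ []
        where
        i∉jk : lookup (A ⊕ j ⊕ k) i ≡ false
        i∉jk = ∉-⊕ (A ⊕ j) (∉-⊕ A i∉ (≢-sym i≢j)) (≢-sym i≢k)

      sets-inside : All (λ t → A ⊂ t × t ⊂ A ⊕ i ⊕ j ⊕ k) (sets i j k)
      sets-inside =
          (⊂-⊕ A i i∉ , ⊂-trans (⊂-⊕ (A ⊕ i) j (∉-⊕ A j∉ i≢j)) ij⊂)
        ∷ (⊂-⊕ A j j∉ , ⊂-trans (subst (A ⊕ j ⊂_) (⊕-comm A j i) (⊂-⊕ (A ⊕ j) i (∉-⊕ A i∉ (≢-sym i≢j)))) ij⊂)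
        ∷ (⊂-⊕ A k k∉ , ⊂-trans (subst (A ⊕ k ⊂_) (⊕-comm A k i) (⊂-⊕ (A ⊕ k) i (∉-⊕ A i∉ (≢-sym i≢k)))) ik⊂)
        ∷ (⊂-⊕-trans j (⊂-⊕ A i i∉) , ij⊂)
        ∷ (⊂-⊕-trans k (⊂-⊕ A i i∉) , ik⊂)
        ∷ (⊂-⊕-trans k (⊂-⊕ A j j∉) , jk⊂) ∷ []
        where
        ij⊂ : A ⊕ i ⊕ j ⊂ A ⊕ i ⊕ j ⊕ k
        ij⊂ = ⊂-⊕ (A ⊕ i ⊕ j) k (∉-⊕ (A ⊕ i) (∉-⊕ A k∉ i≢k) j≢k)
        ik⊂ : A ⊕ i ⊕ k ⊂ A ⊕ i ⊕ j ⊕ k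
        ik⊂ = subst (A ⊕ i ⊕ k ⊂_) (⊕-comm (A ⊕ i) k j)
          (⊂-⊕ (A ⊕ i ⊕ k) j (∉-⊕ (A ⊕ i) (∉-⊕ A j∉ i≢j) (≢-sym j≢k)))
        jk⊂ : A ⊕ j ⊕ k ⊂ A ⊕ i ⊕ j ⊕ k
        jk⊂ = subst (A ⊕ j ⊕ k ⊂_) (trans (⊕-comm (A ⊕ j) k i) (cong (_⊕ k) (⊕-comm A j i)))
          (⊂-⊕ (A ⊕ j ⊕ k) i (∉-⊕ (A ⊕ j) (∉-⊕ A i∉ (≢-sym i≢j)) (≢-sym i≢k)))

      sets-between : ∀ {t} → t ∈ sets i j k → t ∈ F → Between (A ⊕ i ⊕ j ⊕ k) t
      sets-between t∈ t∈F = t∈F , All.lookup sets-inside t∈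

      free⇒q≡0 : free 1 (A ⊕ i ⊕ j ⊕ k) ≡ 1ℤ → q i j k ≡ 0
      free⇒q≡0 z≡1 with q i j k in eq
      ... | zero  = refl
      ... | suc c with count-pos (sets i j k) (subst (1 ℕ.≤_) (sym eq) (ℕ.s≤s ℕ.z≤n))
      ...   | t , t∈ , t∈F with free-cases 1 (A ⊕ i ⊕ j ⊕ k)
      ...     | inj₁ (_ , no-t) = ⊥-elim (no-t t (sets-between t∈ t∈F)
                  (p⊂q⇒∣p∣<∣q∣ (proj₂ (proj₂ (sets-between t∈ t∈F)))))
      ...     | inj₂ (z≡0 , _) with trans (sym z≡0) z≡1
      ...       | ()

      -- Each of the six intermediate sets lies on a third of the chains from A to T, so the left
      -- side is `6 * r !` times the average number of hits strictly above A, less one. For q = 1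
      -- `one-between` gives 2 - 6 + 6 = 2, and for q ≥ 2 there is no hit from T on.
      triple-bound : ∀ r → ∣ A ⊕ i ⊕ j ⊕ k ∣ ℕ.+ r ≡ n →
        + (r !) * (+ 2 * + q i j k - + 6) + + 6 * h r (A ⊕ i ⊕ j ⊕ k) ≤
        + (r !) * weight (q i j k) + + 6 * (free 1 (A ⊕ i ⊕ j ⊕ k) * (h r (A ⊕ i ⊕ j ⊕ k) - + (r !)))
      triple-bound r sz = main
        where
        T : Subset n
        T = A ⊕ i ⊕ j ⊕ k
        w : ℤ
        w = + (r !)
        Bound : ℕ → ℤ → Set
        Bound c z = w * (+ 2 * + c - + 6) + + 6 * h r T ≤ w * weight c + + 6 * (z * (h r T - w))

        h≤w : ∀ {t} → Between T t → + 6 * h r T ≤ + 6 * w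
        h≤w b = ℤₚ.*-monoˡ-≤-nonNeg (+ 6) (one-between r T sz b)

        occupied : ∀ {t} → Between T t → ∀ c → q i j k ≡ c → Bound c 0ℤ
        -- A member strictly between A and T is one of the six sets, so this case is empty; the
        -- inequality holds regardless, which saves proving so.
        occupied b 0 _ = ℤₚ.≤-trans (ℤₚ.+-monoʳ-≤ (w * (+ 2 * 0ℤ - + 6)) (h≤w b)) (ℤₚ.≤-reflexive (eq₀ w (h r T)))
          where
          eq₀ : ∀ w y → w * (+ 2 * 0ℤ - + 6) + + 6 * w ≡ w * 0ℤ + + 6 * (0ℤ * (y - w))
          eq₀ = solve-∀
        occupied b 1 _ = ℤₚ.≤-trans (ℤₚ.+-monoʳ-≤ (w * (+ 2 * 1ℤ - + 6)) (h≤w b)) (ℤₚ.≤-reflexive (eq₁ w (h r T)))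
          where
          eq₁ : ∀ w y → w * (+ 2 * 1ℤ - + 6) + + 6 * w ≡ w * + 2 + + 6 * (0ℤ * (y - w))
          eq₁ = solve-∀
        occupied b (suc (suc c)) eq with count-two (sets i j k) sets-unique
          (subst (2 ℕ.≤_) (sym eq) (ℕ.s≤s (ℕ.s≤s ℕ.z≤n)))
        ... | t , t′ , t∈ , t′∈ , t∈F , t′∈F , t≢t′ = ℤₚ.≤-reflexive (trans
                (cong (λ y → w * x + + 6 * y) (two-between r T (sets-between t∈ t∈F) (sets-between t′∈ t′∈F) t≢t′))
                (eq₂ w x (h r T)))
          where
          x : ℤ
          x = + 2 * + suc (suc c) - + 6
          eq₂ : ∀ w x y → w * x + + 6 * 0ℤ ≡ w * x + + 6 * (0ℤ * (y - w))
          eq₂ = solve-∀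

        main : Bound (q i j k) (free 1 T)
        main with free-cases 1 T
        ... | inj₁ (z≡1 , _) = subst (λ z → Bound (q i j k) z) (sym z≡1)
                (subst (λ c → Bound c 1ℤ) (sym (free⇒q≡0 z≡1)) (ℤₚ.≤-reflexive (eq w (h r T))))
          where
          eq : ∀ w y → w * (+ 2 * 0ℤ - + 6) + + 6 * y ≡ w * 0ℤ + + 6 * (1ℤ * (y - w))
          eq = solve-∀
        ... | inj₂ (z≡0 , t , b , _) = subst (λ z → Bound (q i j k) z) (sym z≡0) (occupied b (q i j k) refl)

    flags : Fin n → Fin n → Fin n → ℤ
    flags i j k = Flag (a i) (a j) (a k) (e i j) (e i k) (e j k)

    product : Fin n → Fin n → Fin n → Fin n → ℤ
    product i j k l = flags i j k * flags i j l

    a-e-compatible : ∀ i j → lookup A i ≡ false → lookup A j ≡ false → i ≢ j → compatible (a i) (a j) (e i j) ≡ true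
    a-e-compatible i j i∉ j∉ i≢j with a i in ai | a j in aj | e i j in eij
    ... | false | _     | _     = refl
    ... | true  | false | _     = refl
    ... | true  | true  | false = refl
    ... | true  | true  | true  = ⊥-elim (diamondFree (A , A ⊕ i , A ⊕ j , A ⊕ i ⊕ j ,
            A∈F , mem-true⁻ F _ ai , mem-true⁻ F _ aj , mem-true⁻ F _ eij ,
            ⊂-⊕ A i i∉ , ⊂-⊕ (A ⊕ i) j (∉-⊕ A j∉ i≢j) ,
            ⊂-⊕ A j j∉ , subst (A ⊕ j ⊂_) (⊕-comm A j i) (⊂-⊕ (A ⊕ j) i (∉-⊕ A i∉ (≢-sym i≢j))) ,
            differ i (∈-⊕ A i) (∉-⊕ A i∉ (≢-sym i≢j))))

    isZero-true : ∀ {c} → c ≡ 0 → isZero c ≡ true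
    isZero-true refl = refl

    -- The certificate applied to the bits of A. A member strictly between A and one of the four
    -- triples is two or more levels below the quadruple, so `free 2` there forces all four counts
    -- to vanish.
    quadruple : ∀ i j k l → lookup A i ≡ false → lookup (A ⊕ i) j ≡ false →
      lookup (A ⊕ i ⊕ j) k ≡ false → lookup (A ⊕ i ⊕ j ⊕ k) l ≡ false →
      (weight (q i j k) + weight (q i j l) + weight (q i k l) + weight (q j k l)) + + 6 * free 2 (A ⊕ i ⊕ j ⊕ k ⊕ l) ≤
      + 6 - (product i j k l + product i k j l + product i l j k + product j k i l + product j l i k + product k l i j)
    quadruple i j k l i∉ j∉ k∉ l∉ = ℤₚ.≤-trans
      (ℤₚ.+-monoʳ-≤ (weight (q i j k) + weight (q i j l) + weight (q i k l) + weight (q j k l))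
        (ℤₚ.*-monoˡ-≤-nonNeg (+ 6) free≤))
      (subst (λ x → Q.weights ≤ + 6 - x) products-eq
        (quadruple-bound (a i) (a j) (a k) (a l) (e i j) (e i k) (e i l) (e j k) (e j l) (e k l) ok))
      where
      module Q = Quadruple (a i) (a j) (a k) (a l) (e i j) (e i k) (e i l) (e j k) (e j l) (e k l)
      fijk : Fresh A i j k
      fijk = toFresh A i j k i∉ j∉ k∉
      open Fresh fijk using (i≢j; i≢k; j≢k) renaming (j∉ to j∉A; k∉ to k∉A)
      fijl : Fresh A i j l
      fijl = toFresh A i j l i∉ j∉ (lookup-⊕⁻ (A ⊕ i ⊕ j) k l l∉)
      open Fresh fijl using () renaming (k∉ to l∉A; i≢k to i≢l; j≢k to j≢l)
      k≢l : k ≢ l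
      k≢l = ∉⊕⇒≢ (A ⊕ i ⊕ j) k l l∉
      fikl : Fresh A i k l
      fikl = fresh i∉ k∉A l∉A i≢k i≢l k≢l
      fjkl : Fresh A j k l
      fjkl = fresh j∉A k∉A l∉A j≢k j≢l k≢l

      ok : Q.allCompatible ≡ true
      ok rewrite a-e-compatible i j i∉ j∉A i≢j | a-e-compatible i k i∉ k∉A i≢k | a-e-compatible i l i∉ l∉A i≢l
               | a-e-compatible j k j∉A k∉A j≢k | a-e-compatible j l j∉A l∉A j≢l | a-e-compatible k l k∉A l∉A k≢l = refl

      -- The certificate names each pair once, with its indices in increasing order.
      products-eq : Q.products ≡
        product i j k l + product i k j l + product i l j k + product j k i l + product j l i k + product k l i j
      products-eq rewrite e-sym k j | e-sym l j | e-sym l k | e-sym j i | e-sym k i | e-sym l i = refl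

      free≡1 : ∀ S x → lookup S x ≡ false → S ⊕ x ≡ A ⊕ i ⊕ j ⊕ k ⊕ l → free 2 (A ⊕ i ⊕ j ⊕ k ⊕ l) ≡ 1ℤ → free 1 S ≡ 1ℤ
      free≡1 S x x∉S eq J≡1 = ℤₚ.≤-antisym (⟦⟧≤1 _) (ℤₚ.≤-trans
        (ℤₚ.≤-reflexive (trans (sym J≡1) (cong (free 2) (sym eq)))) (free₂-⊕ S x x∉S))

      free≤ : free 2 (A ⊕ i ⊕ j ⊕ k ⊕ l) ≤ ⟦ isZero (q i j k) ∧ isZero (q i j l) ∧ isZero (q i k l) ∧ isZero (q j k l) ⟧
      free≤ with free-cases 2 (A ⊕ i ⊕ j ⊕ k ⊕ l)
      ... | inj₂ (J≡0 , _) = ℤₚ.≤-trans (ℤₚ.≤-reflexive J≡0) (⟦⟧≥0 _)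
      ... | inj₁ (J≡1 , _) = ℤₚ.≤-trans (⟦⟧≤1 _) (ℤₚ.≤-reflexive (cong ⟦_⟧ (sym
              (cong₂ _∧_ (isZero-true (free⇒q≡0 fijk (free≡1 (A ⊕ i ⊕ j ⊕ k) l l∉ refl J≡1)))
              (cong₂ _∧_ (isZero-true (free⇒q≡0 fijl (free≡1 (A ⊕ i ⊕ j ⊕ l) k
                  (∉-⊕ (A ⊕ i ⊕ j) k∉ (≢-sym k≢l)) (⊕-comm (A ⊕ i ⊕ j) l k) J≡1)))
              (cong₂ _∧_ (isZero-true (free⇒q≡0 fikl (free≡1 (A ⊕ i ⊕ k ⊕ l) j
                  (∉-⊕ (A ⊕ i ⊕ k) (∉-⊕ (A ⊕ i) j∉ (≢-sym j≢k)) (≢-sym j≢l))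
                  (trans (⊕-comm (A ⊕ i ⊕ k) l j) (cong (_⊕ l) (⊕-comm (A ⊕ i) k j))) J≡1)))
              (isZero-true (free⇒q≡0 fjkl (free≡1 (A ⊕ j ⊕ k ⊕ l) i
                  (∉-⊕ (A ⊕ j ⊕ k) (∉-⊕ (A ⊕ j) (∉-⊕ A i∉ (≢-sym i≢j)) (≢-sym i≢k)) (≢-sym i≢l))
                  (trans (⊕-comm (A ⊕ j ⊕ k) l i) (cong (_⊕ l)
                    (trans (⊕-comm (A ⊕ j) k i) (cong (_⊕ k) (⊕-comm A j i))))) J≡1)))))))))

    -- Chains above a triple, all chains from A, ordered triples and ordered quadruples; hence
    -- `w * N₃` and `p ! * N₄` both equal M.
    w M N₃ N₄ : ℤ
    w  = + (suc p !)
    M  = + ((4 ℕ.+ p) !)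
    N₃ = Σ³ A (λ _ _ _ → 1ℤ)
    N₄ = Σ⁴ A (λ _ _ _ _ → 1ℤ)

    size₁ : ∀ i → lookup A i ≡ false → ∣ A ⊕ i ∣ ℕ.+ (3 ℕ.+ p) ≡ n
    size₁ i i∉ = size-⊕ A i i∉ size

    size₂ : ∀ i j → lookup A i ≡ false → lookup (A ⊕ i) j ≡ false → ∣ A ⊕ i ⊕ j ∣ ℕ.+ (2 ℕ.+ p) ≡ n
    size₂ i j i∉ j∉ = size-⊕ (A ⊕ i) j j∉ (size₁ i i∉)

    size₃ : ∀ i j k → lookup A i ≡ false → lookup (A ⊕ i) j ≡ false → lookup (A ⊕ i ⊕ j) k ≡ false →
      ∣ A ⊕ i ⊕ j ⊕ k ∣ ℕ.+ (1 ℕ.+ p) ≡ n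
    size₃ i j k i∉ j∉ k∉ = size-⊕ (A ⊕ i ⊕ j) k k∉ (size₂ i j i∉ j∉)

    Σ³-const : ∀ c → Σ³ A (λ _ _ _ → c) ≡ + (4 ℕ.+ p) * (+ (3 ℕ.+ p) * (+ (2 ℕ.+ p) * c))
    Σ³-const c = trans (Σ∉-cong A (λ i i∉ → trans
        (Σ∉-cong (A ⊕ i) (λ j j∉ → Σ∉-const (A ⊕ i ⊕ j) (size₂ i j i∉ j∉) c))
        (Σ∉-const (A ⊕ i) (size₁ i i∉) _)))
      (Σ∉-const A size _)

    Σ⁴-last : ∀ (f : Fin n → Fin n → Fin n → ℤ) → Σ⁴ A (λ i j k _ → f i j k) ≡ + suc p * Σ³ A f
    Σ⁴-last f = trans
      (Σ∉-cong A (λ i i∉ → Σ∉-cong (A ⊕ i) (λ j j∉ → Σ∉-cong (A ⊕ i ⊕ j) (λ k k∉ →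
        Σ∉-const (A ⊕ i ⊕ j ⊕ k) (size₃ i j k i∉ j∉ k∉) (f i j k)))))
      (Σ³-* A (+ suc p) f)

    factorial : ∀ r → + (suc r !) ≡ + suc r * + (r !)
    factorial r = ℤₚ.pos-* (suc r) (r !)

    p!*Σ⁴-last : ∀ (f : Fin n → Fin n → Fin n → ℤ) → + (p !) * Σ⁴ A (λ i j k _ → f i j k) ≡ w * Σ³ A f
    p!*Σ⁴-last f = trans (cong (+ (p !) *_) (Σ⁴-last f))
      (trans (rearrange (+ (p !)) (+ suc p) (Σ³ A f)) (cong (_* Σ³ A f) (sym (factorial p))))
      where
      rearrange : ∀ x y z → x * (y * z) ≡ (y * x) * z
      rearrange = solve-∀

    w*N₃ : w * N₃ ≡ M
    w*N₃ = begin
      w * N₃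
        ≡⟨ cong (w *_) (Σ³-const 1ℤ) ⟩
      w * (+ (4 ℕ.+ p) * (+ (3 ℕ.+ p) * (+ (2 ℕ.+ p) * 1ℤ)))
        ≡⟨ rearrange w (+ (4 ℕ.+ p)) (+ (3 ℕ.+ p)) (+ (2 ℕ.+ p)) ⟩
      + (4 ℕ.+ p) * (+ (3 ℕ.+ p) * (+ (2 ℕ.+ p) * w))
        ≡⟨ cong (λ x → + (4 ℕ.+ p) * (+ (3 ℕ.+ p) * x)) (sym (factorial (1 ℕ.+ p))) ⟩
      + (4 ℕ.+ p) * (+ (3 ℕ.+ p) * + ((2 ℕ.+ p) !))
        ≡⟨ cong (+ (4 ℕ.+ p) *_) (sym (factorial (2 ℕ.+ p))) ⟩
      + (4 ℕ.+ p) * + ((3 ℕ.+ p) !)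
        ≡⟨ sym (factorial (3 ℕ.+ p)) ⟩
      M ∎
      where
      open ≡-Reasoning
      rearrange : ∀ w x y z → w * (x * (y * (z * 1ℤ))) ≡ x * (y * (z * w))
      rearrange = solve-∀

    p!*N₄ : + (p !) * N₄ ≡ M
    p!*N₄ = trans (p!*Σ⁴-last (λ _ _ _ → 1ℤ)) w*N₃

    top : Fin n → Fin n → Fin n → ℤ
    top i j k = h (suc p) (A ⊕ i ⊕ j ⊕ k)

    Sa Se Sh : ℤ
    Sa = Σ³ A (λ i _ _ → ⟦ a i ⟧)
    Se = Σ³ A (λ i j _ → ⟦ e i j ⟧)
    Sh = Σ³ A top

    -- Chains are grouped by their first three elements: M counts the hits at A itself, then come
    -- levels one and two, and `Sh` collects everything from level three on.
    hits : h (4 ℕ.+ p) A ≡ M + (w * Sa + (w * Se + Sh))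
    hits = cong₂ _+_ (trans (cong (λ b → M * ⟦ b ⟧) (mem-true A∈F)) (ℤₚ.*-identityʳ M)) (begin
      Σ∉ A (λ i → h (3 ℕ.+ p) (A ⊕ i))
        ≡⟨ Σ∉-cong A level₁ ⟩
      Σ³ A (λ i j k → w * ⟦ a i ⟧ + (w * ⟦ e i j ⟧ + top i j k))
        ≡⟨ trans (Σ³-+ A _ _) (cong₂ _+_ (Σ³-* A w _) (trans (Σ³-+ A _ _) (cong (_+ Sh) (Σ³-* A w _)))) ⟩
      w * Sa + (w * Se + Sh) ∎)
      where
      open ≡-Reasoning
      level₂ : ∀ i j → lookup A i ≡ false → lookup (A ⊕ i) j ≡ false →
        h (2 ℕ.+ p) (A ⊕ i ⊕ j) ≡ Σ∉ (A ⊕ i ⊕ j) (λ k → w * ⟦ e i j ⟧ + top i j k)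
      level₂ i j i∉ j∉ = sym (trans (Σ∉-+ (A ⊕ i ⊕ j) (λ _ → w * ⟦ e i j ⟧) (top i j))
        (cong (_+ Σ∉ (A ⊕ i ⊕ j) (top i j)) (trans (Σ∉-const (A ⊕ i ⊕ j) (size₂ i j i∉ j∉) (w * ⟦ e i j ⟧))
          (trans (sym (ℤₚ.*-assoc (+ (2 ℕ.+ p)) w ⟦ e i j ⟧)) (cong (_* ⟦ e i j ⟧) (sym (factorial (1 ℕ.+ p))))))))
      level₁ : ∀ i → lookup A i ≡ false →
        h (3 ℕ.+ p) (A ⊕ i) ≡ Σ² (A ⊕ i) (λ j k → w * ⟦ a i ⟧ + (w * ⟦ e i j ⟧ + top i j k))
      level₁ i i∉ = begin
        + ((3 ℕ.+ p) !) * ⟦ a i ⟧ + Σ∉ (A ⊕ i) (λ j → h (2 ℕ.+ p) (A ⊕ i ⊕ j))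
          ≡⟨ cong₂ _+_ constant (Σ∉-cong (A ⊕ i) (λ j → level₂ i j i∉)) ⟩
        Σ∉ (A ⊕ i) (λ j → Σ∉ (A ⊕ i ⊕ j) (λ _ → w * ⟦ a i ⟧)) +
          Σ∉ (A ⊕ i) (λ j → Σ∉ (A ⊕ i ⊕ j) (λ k → w * ⟦ e i j ⟧ + top i j k))
          ≡⟨ sym (Σ∉-+ (A ⊕ i) _ _) ⟩
        Σ∉ (A ⊕ i) (λ j → Σ∉ (A ⊕ i ⊕ j) (λ _ → w * ⟦ a i ⟧) + Σ∉ (A ⊕ i ⊕ j) (λ k → w * ⟦ e i j ⟧ + top i j k))
          ≡⟨ Σ∉-cong (A ⊕ i) (λ j _ → sym (Σ∉-+ (A ⊕ i ⊕ j) (λ _ → w * ⟦ a i ⟧) _)) ⟩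
        Σ² (A ⊕ i) (λ j k → w * ⟦ a i ⟧ + (w * ⟦ e i j ⟧ + top i j k)) ∎
        where
        constant : + ((3 ℕ.+ p) !) * ⟦ a i ⟧ ≡ Σ∉ (A ⊕ i) (λ j → Σ∉ (A ⊕ i ⊕ j) (λ _ → w * ⟦ a i ⟧))
        constant = sym (begin
          Σ∉ (A ⊕ i) (λ j → Σ∉ (A ⊕ i ⊕ j) (λ _ → w * ⟦ a i ⟧))
            ≡⟨ Σ∉-cong (A ⊕ i) (λ j j∉ → Σ∉-const (A ⊕ i ⊕ j) (size₂ i j i∉ j∉) (w * ⟦ a i ⟧)) ⟩
          Σ∉ (A ⊕ i) (λ _ → + (2 ℕ.+ p) * (w * ⟦ a i ⟧))
            ≡⟨ Σ∉-const (A ⊕ i) (size₁ i i∉) _ ⟩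
          + (3 ℕ.+ p) * (+ (2 ℕ.+ p) * (w * ⟦ a i ⟧))
            ≡⟨ rearrange (+ (3 ℕ.+ p)) (+ (2 ℕ.+ p)) w ⟦ a i ⟧ ⟩
          + (3 ℕ.+ p) * (+ (2 ℕ.+ p) * w) * ⟦ a i ⟧
            ≡⟨ cong (λ x → + (3 ℕ.+ p) * x * ⟦ a i ⟧) (sym (factorial (1 ℕ.+ p))) ⟩
          + (3 ℕ.+ p) * + ((2 ℕ.+ p) !) * ⟦ a i ⟧
            ≡⟨ cong (_* ⟦ a i ⟧) (sym (factorial (2 ℕ.+ p))) ⟩
          + ((3 ℕ.+ p) !) * ⟦ a i ⟧ ∎)
          where
          rearrange : ∀ x y z t → x * (y * (z * t)) ≡ x * (y * z) * t
          rearrange = solve-∀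

    +♯ : ∀ b → + ♯ b ≡ ⟦ b ⟧
    +♯ true  = refl
    +♯ false = refl

    q-sum : Σ³ A (λ i j k → + q i j k) ≡ + 3 * Sa + + 3 * Se
    q-sum = begin
      Σ³ A (λ i j k → + q i j k)
        ≡⟨ Σ∉-cong A (λ i _ → Σ∉-cong (A ⊕ i) (λ j _ → Σ∉-cong (A ⊕ i ⊕ j) (λ k _ → split i j k))) ⟩
      Σ³ A (λ i j k → ⟦ a i ⟧ + (⟦ a j ⟧ + (⟦ a k ⟧ + (⟦ e i j ⟧ + (⟦ e i k ⟧ + ⟦ e j k ⟧)))))
        ≡⟨ trans (Σ³-+ A _ _) (cong (λ x → Sa + x) (trans (Σ³-+ A _ _) (cong₂ _+_ a₂ (trans (Σ³-+ A _ _) (cong₂ _+_ a₃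
             (trans (Σ³-+ A _ _) (cong (λ x → Se + x) (trans (Σ³-+ A _ _) (cong₂ _+_ e₂ e₃))))))))) ⟩
      Sa + (Sa + (Sa + (Se + (Se + Se))))
        ≡⟨ collect Sa Se ⟩
      + 3 * Sa + + 3 * Se ∎
      where
      open ≡-Reasoning
      split : ∀ i j k → + q i j k ≡ ⟦ a i ⟧ + (⟦ a j ⟧ + (⟦ a k ⟧ + (⟦ e i j ⟧ + (⟦ e i k ⟧ + ⟦ e j k ⟧))))
      split i j k = cong₂ _+_ (+♯ (a i)) (cong₂ _+_ (+♯ (a j)) (cong₂ _+_ (+♯ (a k))
        (cong₂ _+_ (+♯ (e i j)) (cong₂ _+_ (+♯ (e i k)) (trans (ℤₚ.+-identityʳ (+ ♯ (e j k))) (+♯ (e j k)))))))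
      a₂ : Σ³ A (λ _ j _ → ⟦ a j ⟧) ≡ Sa
      a₂ = Σ³-swap₁₂ A _
      a₃ : Σ³ A (λ _ _ k → ⟦ a k ⟧) ≡ Sa
      a₃ = trans (Σ³-swap₂₃ A _) a₂
      e₂ : Σ³ A (λ i _ k → ⟦ e i k ⟧) ≡ Se
      e₂ = Σ³-swap₂₃ A _
      e₃ : Σ³ A (λ _ j k → ⟦ e j k ⟧) ≡ Se
      e₃ = trans (Σ³-swap₁₂ A _) e₂
      collect : ∀ x y → x + (x + (x + (y + (y + y)))) ≡ + 3 * x + + 3 * y
      collect = solve-∀

    SW : ℤ
    SW = Σ³ A (λ i j k → weight (q i j k))

    -- `triple-bound` summed over all ordered triples. The 12 is six times two hits: A itself and
    -- the one hit subtracted in the excess.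
    triples : + 6 * h (4 ℕ.+ p) A ≤ + 12 * M + (w * SW + + 6 * excess 3 (suc p))
    triples = begin
      + 6 * h (4 ℕ.+ p) A
        ≡⟨ cong (+ 6 *_) hits ⟩
      + 6 * (M + (w * Sa + (w * Se + Sh)))
        ≡⟨ trans (rearrange M w Sa Se Sh) (cong (λ x → + 12 * M + ((w * (+ 2 * (+ 3 * Sa + + 3 * Se)) - + 6 * x) + + 6 * Sh)) (sym w*N₃)) ⟩
      + 12 * M + ((w * (+ 2 * (+ 3 * Sa + + 3 * Se)) - + 6 * (w * N₃)) + + 6 * Sh)
        ≡⟨ cong (λ x → + 12 * M + x) (sym sum-lhs) ⟩
      + 12 * M + Σ³ A (λ i j k → w * (+ 2 * + q i j k - + 6) + + 6 * top i j k)
        ≤⟨ ℤₚ.+-monoʳ-≤ (+ 12 * M) (Σ∉-mono A (λ i i∉ → Σ∉-mono (A ⊕ i) (λ j j∉ → Σ∉-mono (A ⊕ i ⊕ j) (λ k k∉ →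
             triple-bound (toFresh A i j k i∉ j∉ k∉) (suc p) (size₃ i j k i∉ j∉ k∉))))) ⟩
      + 12 * M + Σ³ A (λ i j k → w * weight (q i j k) + + 6 * ex i j k)
        ≡⟨ cong (λ x → + 12 * M + x) (trans (Σ³-+ A _ _) (cong₂ _+_ (Σ³-* A w _) (Σ³-* A (+ 6) _))) ⟩
      + 12 * M + (w * SW + + 6 * excess 3 (suc p)) ∎
      where
      open ℤₚ.≤-Reasoning
      ex : Fin n → Fin n → Fin n → ℤ
      ex i j k = free 1 (A ⊕ i ⊕ j ⊕ k) * (top i j k - w)
      rearrange : ∀ M w x y z →
        + 6 * (M + (w * x + (w * y + z))) ≡ + 12 * M + ((w * (+ 2 * (+ 3 * x + + 3 * y)) - + 6 * M) + + 6 * z)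
      rearrange = solve-∀
      sum-lhs : Σ³ A (λ i j k → w * (+ 2 * + q i j k - + 6) + + 6 * top i j k) ≡
        (w * (+ 2 * (+ 3 * Sa + + 3 * Se)) - + 6 * (w * N₃)) + + 6 * Sh
      sum-lhs = trans (Σ³-+ A _ _) (cong₂ _+_
        (trans (Σ³-* A w _) (trans (cong (w *_) (trans (Σ³-+ A (λ i j k → + 2 * + q i j k) (λ _ _ _ → - + 6))
          (cong₂ _+_ (trans (Σ³-* A (+ 2) _) (cong (+ 2 *_) q-sum)) (Σ³-* A (- + 6) (λ _ _ _ → 1ℤ)))))
          (distribute w (+ 2 * (+ 3 * Sa + + 3 * Se)) N₃)))
        (Σ³-* A (+ 6) top))
        where
        distribute : ∀ w x y → w * (x + - + 6 * y) ≡ w * x - + 6 * (w * y)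
        distribute = solve-∀

    Sf : ℤ
    Sf = Σ⁴ A product

    flag-square : ∀ aₖ ij ik jk → - 1ℤ ≤ - 1ℤ * (flag aₖ ij ik jk * flag aₖ ij ik jk)
    flag-square aₖ ij ik jk = ℤₚ.≤ᵇ⇒≤ (subst IsTrue (sym (everywhere-sound 4 test refl (aₖ ∷ ij ∷ ik ∷ jk ∷ []))) tt)
      where
      test : Vec Bool 4 → Bool
      test (aₖ ∷ ij ∷ ik ∷ jk ∷ []) = - 1ℤ ≤ᵇ - 1ℤ * (flag aₖ ij ik jk * flag aₖ ij ik jk)

    -- For a fixed pair the products over distinct k, l form a square less its diagonal, and each
    -- diagonal entry is at most 1. The loss is thus one per triple, a lower order than the number
    -- of quadruples.
    -N₃≤Sf : - 1ℤ * N₃ ≤ Sf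
    -N₃≤Sf = begin
      - 1ℤ * N₃
        ≡⟨ sym (Σ³-* A (- 1ℤ) (λ _ _ _ → 1ℤ)) ⟩
      Σ³ A (λ _ _ _ → - 1ℤ)
        ≤⟨ Σ∉-mono A (λ i _ → Σ∉-mono (A ⊕ i) (λ j _ → inner i j)) ⟩
      Sf ∎
      where
      open ℤₚ.≤-Reasoning
      inner : ∀ i j → Σ∉ (A ⊕ i ⊕ j) (λ _ → - 1ℤ) ≤ Σ² (A ⊕ i ⊕ j) (λ k l → flags i j k * flags i j l)
      inner i j = begin
        Σ∉ B (λ _ → - 1ℤ)                                    ≤⟨ Σ∉-mono B (λ k _ → flag-square (a k) (link (a i) (a j) (e i j)) (link (a i) (a k) (e i k)) (link (a j) (a k) (e j k))) ⟩
        Σ∉ B (λ k → - 1ℤ * (flags i j k * flags i j k))      ≡⟨ Σ∉-* B (- 1ℤ) _ ⟩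
        - 1ℤ * Σ∉ B (λ k → flags i j k * flags i j k)        ≡⟨ ℤₚ.-1*i≡-i _ ⟩
        - Σ∉ B (λ k → flags i j k * flags i j k)             ≤⟨ Σ²-product B (flags i j) ⟩
        Σ² B (λ k l → flags i j k * flags i j l)             ∎
        where
        B = A ⊕ i ⊕ j

    quadruples : + 4 * Σ⁴ A (λ i j k _ → weight (q i j k)) + + 6 * U 4 (free 2) A ≤ + 6 * N₄ + - + 6 * Sf
    quadruples = begin
      + 4 * Σ⁴ A (λ i j k _ → weight (q i j k)) + + 6 * U 4 (free 2) A
        ≡⟨ sym (trans (Σ⁴-+ A _ _) (cong₂ _+_ (Σ⁴-triples A (λ i j k → weight (q i j k))) (Σ⁴-* A (+ 6) _))) ⟩
      Σ⁴ A (λ i j k l → (weight (q i j k) + weight (q i j l) + weight (q i k l) + weight (q j k l))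
                        + + 6 * free 2 (A ⊕ i ⊕ j ⊕ k ⊕ l))
        ≤⟨ Σ∉-mono A (λ i i∉ → Σ∉-mono (A ⊕ i) (λ j j∉ → Σ∉-mono (A ⊕ i ⊕ j) (λ k k∉ →
             Σ∉-mono (A ⊕ i ⊕ j ⊕ k) (λ l l∉ → ℤₚ.≤-trans (quadruple i j k l i∉ j∉ k∉ l∉)
               (ℤₚ.≤-reflexive (cong (λ x → + 6 + x) (sym (ℤₚ.-1*i≡-i (six i j k l))))))))) ⟩
      Σ⁴ A (λ i j k l → + 6 + - 1ℤ * six i j k l)
        ≡⟨ trans (Σ⁴-+ A (λ _ _ _ _ → + 6) _) (cong₂ _+_ (Σ⁴-* A (+ 6) (λ _ _ _ _ → 1ℤ))
             (trans (Σ⁴-* A (- 1ℤ) six) (trans (cong (- 1ℤ *_) (Σ⁴-pairs A product)) (sym (ℤₚ.*-assoc (- 1ℤ) (+ 6) Sf))))) ⟩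
      + 6 * N₄ + - + 6 * Sf ∎
      where
      open ℤₚ.≤-Reasoning
      six : Fin n → Fin n → Fin n → Fin n → ℤ
      six i j k l = product i j k l + product i k j l + product i l j k + product j k i l + product j l i k + product k l i j

    -- In units of 24: 48 for the two hits and 6 from the certificate, and 54/24 = 9/4. The diagonal
    -- costs 6 per triple; since N₄ = (p + 1) N₃, this adds only 1 / (4 (p + 1)).
    chain-bound : + 4 * (+ suc p * h (4 ℕ.+ p) A) ≤ (+ 9 * + suc p + 1ℤ) * M
    chain-bound = ℤₚ.*-cancelˡ-≤-pos _ _ (+ 6) (begin
      + 6 * (+ 4 * (+ suc p * h (4 ℕ.+ p) A))
        ≡⟨ r₁ (+ suc p) (h (4 ℕ.+ p) A) ⟩
      + suc p * (+ 4 * (+ 6 * h (4 ℕ.+ p) A))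
        ≤⟨ ℤₚ.*-monoˡ-≤-nonNeg (+ suc p) (ℤₚ.*-monoˡ-≤-nonNeg (+ 4) triples) ⟩
      + suc p * (+ 4 * (+ 12 * M + (w * SW + + 6 * excess 3 (suc p))))
        ≡⟨ r₂ (+ suc p) M (w * SW) (excess 3 (suc p)) ⟩
      + suc p * (+ 48 * M + (+ 4 * (w * SW) + + 6 * (+ 4 * excess 3 (suc p))))
        ≤⟨ ℤₚ.*-monoˡ-≤-nonNeg (+ suc p) (ℤₚ.+-monoʳ-≤ (+ 48 * M) (ℤₚ.+-monoʳ-≤ (+ 4 * (w * SW))
             (ℤₚ.*-monoˡ-≤-nonNeg (+ 6) (excess-step p 3 ℕₚ.≤-refl size′)))) ⟩
      + suc p * (+ 48 * M + (+ 4 * (w * SW) + + 6 * (+ (p !) * U 4 (free 2) A)))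
        ≡⟨ cong (λ x → + suc p * (+ 48 * M + (+ 4 * x + + 6 * (+ (p !) * U 4 (free 2) A))))
             (sym (p!*Σ⁴-last (λ i j k → weight (q i j k)))) ⟩
      + suc p * (+ 48 * M + (+ 4 * (+ (p !) * S₄) + + 6 * (+ (p !) * U 4 (free 2) A)))
        ≡⟨ cong (λ x → + suc p * (+ 48 * M + x)) (r₃ (+ (p !)) S₄ (U 4 (free 2) A)) ⟩
      + suc p * (+ 48 * M + + (p !) * (+ 4 * S₄ + + 6 * U 4 (free 2) A))
        ≤⟨ ℤₚ.*-monoˡ-≤-nonNeg (+ suc p) (ℤₚ.+-monoʳ-≤ (+ 48 * M) (ℤₚ.*-monoˡ-≤-nonNeg (+ (p !)) (ℤₚ.≤-trans quadruples
             (ℤₚ.+-monoʳ-≤ (+ 6 * N₄) (ℤₚ.*-monoˡ-≤-nonPos (- + 6) -N₃≤Sf))))) ⟩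
      + suc p * (+ 48 * M + + (p !) * (+ 6 * N₄ + - + 6 * (- 1ℤ * N₃)))
        ≡⟨ r₄ (+ suc p) M (+ (p !)) N₄ N₃ ⟩
      + suc p * (+ 48 * M + + 6 * (+ (p !) * N₄)) + + 6 * ((+ suc p * + (p !)) * N₃)
        ≡⟨ cong₂ (λ x y → + suc p * (+ 48 * M + + 6 * x) + + 6 * y) p!*N₄ (trans (cong (_* N₃) (sym (factorial p))) w*N₃) ⟩
      + suc p * (+ 48 * M + + 6 * M) + + 6 * M
        ≡⟨ r₅ (+ suc p) M ⟩
      + 6 * ((+ 9 * + suc p + 1ℤ) * M) ∎)
      where
      open ℤₚ.≤-Reasoning
      S₄ : ℤ
      S₄ = Σ⁴ A (λ i j k _ → weight (q i j k))
      size′ : ∣ A ∣ ℕ.+ 3 ℕ.+ suc p ≡ n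
      size′ = trans (ℕₚ.+-assoc ∣ A ∣ 3 (suc p)) size
      r₁ : ∀ c x → + 6 * (+ 4 * (c * x)) ≡ c * (+ 4 * (+ 6 * x))
      r₁ = solve-∀
      r₂ : ∀ c m x y → c * (+ 4 * (+ 12 * m + (x + + 6 * y))) ≡ c * (+ 48 * m + (+ 4 * x + + 6 * (+ 4 * y)))
      r₂ = solve-∀
      r₃ : ∀ c x y → + 4 * (c * x) + + 6 * (c * y) ≡ c * (+ 4 * x + + 6 * y)
      r₃ = solve-∀
      r₄ : ∀ c m f x y → c * (+ 48 * m + f * (+ 6 * x + - + 6 * (- 1ℤ * y))) ≡ c * (+ 48 * m + + 6 * (f * x)) + + 6 * ((c * f) * y)
      r₄ = solve-∀
      r₅ : ∀ c m → c * (+ 48 * m + + 6 * m) + + 6 * m ≡ + 6 * ((+ 9 * c + 1ℤ) * m)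
      r₅ = solve-∀

  -- Factorials and the central binomial coefficient

  -- Induction on the gap d between the two arguments: moving one unit from the larger to the
  -- smaller does not increase the product of the factorials.
  central-factorials : ∀ d k → ⌊ k ℕ.+ (k ℕ.+ d) /2⌋ ! ℕ.* ⌈ k ℕ.+ (k ℕ.+ d) /2⌉ ! ℕ.≤ k ! ℕ.* (k ℕ.+ d) !
  central-factorials zero k rewrite ℕₚ.+-identityʳ k =
    ℕₚ.≤-reflexive (cong₂ (λ x y → x ! ℕ.* y !) (sym (ℕₚ.n≡⌊n+n/2⌋ k)) (sym (ℕₚ.n≡⌈n+n/2⌉ k)))
  central-factorials (suc zero) k rewrite ℕₚ.+-comm k 1 | ℕₚ.+-suc k k =
    ℕₚ.≤-reflexive (cong₂ (λ x y → x ! ℕ.* y !) (sym (ℕₚ.n≡⌈n+n/2⌉ k)) (cong suc (sym (ℕₚ.n≡⌊n+n/2⌋ k))))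
  central-factorials (suc (suc d)) k = ℕₚ.≤-trans
    (subst (λ x → ⌊ x /2⌋ ! ℕ.* ⌈ x /2⌉ ! ℕ.≤ suc k ! ℕ.* (suc k ℕ.+ d) !) (shift k d) (central-factorials d (suc k)))
    (begin
      suc k ! ℕ.* (suc k ℕ.+ d) !                   ≡⟨ move (suc k) (k !) ((suc k ℕ.+ d) !) ⟩
      k ! ℕ.* (suc k ℕ.* (suc k ℕ.+ d) !)           ≤⟨ ℕₚ.*-monoʳ-≤ (k !) (ℕₚ.*-monoˡ-≤ ((suc k ℕ.+ d) !) (ℕₚ.≤-trans (ℕₚ.m≤m+n (suc k) d) (ℕₚ.n≤1+n _))) ⟩
      k ! ℕ.* (suc (suc k ℕ.+ d)) !                 ≡⟨ cong (λ x → k ! ℕ.* x !) (sym (trans (ℕₚ.+-suc k (suc d)) (cong suc (ℕₚ.+-suc k d)))) ⟩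
      k ! ℕ.* (k ℕ.+ suc (suc d)) !                 ∎)
    where
    open ℕₚ.≤-Reasoning
    move : ∀ x y z → x ℕ.* y ℕ.* z ≡ y ℕ.* (x ℕ.* z)
    move = solveℕ-∀
    shift : ∀ k d → suc k ℕ.+ (suc k ℕ.+ d) ≡ k ℕ.+ (k ℕ.+ suc (suc d))
    shift = solveℕ-∀

  central : ℕ → ℕ
  central n = n C ⌊ n /2⌋

  central-spec : ∀ n → central n ℕ.* (⌊ n /2⌋ ! ℕ.* ⌈ n /2⌉ !) ≡ n !
  central-spec n = trans
    (cong (λ x → central n ℕ.* (⌊ n /2⌋ ! ℕ.* x !)) (sym n∸⌊n/2⌋))
    (trans (cong (ℕ._* (⌊ n /2⌋ ! ℕ.* (n ℕ.∸ ⌊ n /2⌋) !)) (nCk≡n!/k![n-k]! (ℕₚ.⌊n/2⌋≤n n)))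
      (m/n*n≡m (k![n∸k]!∣n! (ℕₚ.⌊n/2⌋≤n n))))
    where
    instance _ = ℕₚ._!*_!≢0 ⌊ n /2⌋ (n ℕ.∸ ⌊ n /2⌋)
    n∸⌊n/2⌋ : n ℕ.∸ ⌊ n /2⌋ ≡ ⌈ n /2⌉
    n∸⌊n/2⌋ = trans (cong (ℕ._∸ ⌊ n /2⌋) (sym (ℕₚ.⌊n/2⌋+⌈n/2⌉≡n n))) (ℕₚ.m+n∸m≡n ⌊ n /2⌋ ⌈ n /2⌉)

  n!≤central : ∀ k j → (k ℕ.+ j) ! ℕ.≤ k ! ℕ.* j ! ℕ.* central (k ℕ.+ j)
  n!≤central k j = begin
    (k ℕ.+ j) !                                             ≡⟨ sym (central-spec (k ℕ.+ j)) ⟩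
    central (k ℕ.+ j) ℕ.* (⌊ k ℕ.+ j /2⌋ ! ℕ.* ⌈ k ℕ.+ j /2⌉ !)  ≤⟨ ℕₚ.*-monoʳ-≤ (central (k ℕ.+ j)) (minimal k j) ⟩
    central (k ℕ.+ j) ℕ.* (k ! ℕ.* j !)                     ≡⟨ ℕₚ.*-comm (central (k ℕ.+ j)) _ ⟩
    k ! ℕ.* j ! ℕ.* central (k ℕ.+ j)                       ∎
    where
    open ℕₚ.≤-Reasoning
    ordered : ∀ k j → k ℕ.≤ j → ⌊ k ℕ.+ j /2⌋ ! ℕ.* ⌈ k ℕ.+ j /2⌉ ! ℕ.≤ k ! ℕ.* j !
    ordered k j k≤j = subst (λ x → ⌊ k ℕ.+ x /2⌋ ! ℕ.* ⌈ k ℕ.+ x /2⌉ ! ℕ.≤ k ! ℕ.* x !)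
      (ℕₚ.m+[n∸m]≡n k≤j) (central-factorials (j ℕ.∸ k) k)
    minimal : ∀ k j → ⌊ k ℕ.+ j /2⌋ ! ℕ.* ⌈ k ℕ.+ j /2⌉ ! ℕ.≤ k ! ℕ.* j !
    minimal k j with ℕₚ.≤-total k j
    ... | inj₁ k≤j = ordered k j k≤j
    ... | inj₂ j≤k rewrite ℕₚ.+-comm k j | ℕₚ.*-comm (k !) (j !) = ordered j k j≤k

  -- Far from the middle, the neighbouring level one step closer is already larger by the factor (k
  -- + 1) / (j + 1) ≥ X, and that level is at most the central one.
  X*n!≤central : ∀ X k j → X ℕ.* suc j ℕ.≤ suc k →
    X ℕ.* (suc k ℕ.+ j) ! ℕ.≤ suc k ! ℕ.* j ! ℕ.* central (suc k ℕ.+ j)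
  X*n!≤central X k j X≤k = begin
    X ℕ.* (suc k ℕ.+ j) !                                   ≤⟨ ℕₚ.*-monoʳ-≤ X (subst (λ x → x ! ℕ.≤ k ! ℕ.* suc j ! ℕ.* central x) (ℕₚ.+-suc k j) (n!≤central k (suc j))) ⟩
    X ℕ.* (k ! ℕ.* (suc j ℕ.* j !) ℕ.* c)                   ≡⟨ r₁ X (k !) (suc j) (j !) c ⟩
    (X ℕ.* suc j) ℕ.* (k ! ℕ.* j ! ℕ.* c)                   ≤⟨ ℕₚ.*-monoˡ-≤ (k ! ℕ.* j ! ℕ.* c) X≤k ⟩
    suc k ℕ.* (k ! ℕ.* j ! ℕ.* c)                           ≡⟨ r₂ (suc k) (k !) (j !) c ⟩
    suc k ! ℕ.* j ! ℕ.* c                                   ∎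
    where
    open ℕₚ.≤-Reasoning
    c = central (suc k ℕ.+ j)
    r₁ : ∀ x a b d c → x ℕ.* (a ℕ.* (b ℕ.* d) ℕ.* c) ≡ (x ℕ.* b) ℕ.* (a ℕ.* d ℕ.* c)
    r₁ = solveℕ-∀
    r₂ : ∀ s a b c → s ℕ.* (a ℕ.* b ℕ.* c) ≡ s ℕ.* a ℕ.* b ℕ.* c
    r₂ = solveℕ-∀

  -- Counting the chains through the members of a family

  ⊆∧≡⇒≡ : {S T : Subset n} → S ⊆ T → ∣ S ∣ ≡ ∣ T ∣ → S ≡ T
  ⊆∧≡⇒≡ {S = []} {[]} _ _ = refl
  ⊆∧≡⇒≡ {S = true  ∷ S} {true  ∷ T} p e = cong (λ R → true ∷ R) (⊆∧≡⇒≡ (drop-∷-⊆ p) (ℕₚ.suc-injective e))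
  ⊆∧≡⇒≡ {S = true  ∷ S} {false ∷ T} p e with p here
  ... | ()
  ⊆∧≡⇒≡ {S = false ∷ S} {true  ∷ T} p e = ⊥-elim (ℕₚ.<-irrefl e (s≤s (p⊆q⇒∣p∣≤∣q∣ (drop-∷-⊆ p))))
  ⊆∧≡⇒≡ {S = false ∷ S} {false ∷ T} p e = cong (λ R → false ∷ R) (⊆∧≡⇒≡ (drop-∷-⊆ p) e)

  ⊕-⊆ : {S D : Subset n} {i : Fin n} → S ⊆ D → lookup D i ≡ true → S ⊕ i ⊆ D
  ⊕-⊆ {S = S} {D} {i} S⊆D i∈D = ⊆-lookup inside
    where
    inside : ∀ j → lookup (S ⊕ i) j ≡ true → lookup D j ≡ true
    inside j p with j ≟ᶠ i
    ... | yes refl = i∈D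
    ... | no j≢i   = []=⇒lookup (S⊆D (lookup⇒[]= j S (trans (sym (lookup∘update′ j≢i S true)) p)))

  toReach : ∀ s {S D : Subset n} → S ⊆ D → ∣ D ∣ ≡ ∣ S ∣ ℕ.+ s → Reach s S D
  toReach zero {S} S⊆D e = subst (Reach zero S) (⊆∧≡⇒≡ S⊆D (sym (trans e (ℕₚ.+-identityʳ _)))) done
  toReach (suc s) {S} {D} S⊆D e with ⊆∧<⇒⊂ S⊆D (subst (∣ S ∣ ℕ.<_) (sym e) (ℕₚ.m<m+n ∣ S ∣ (s≤s z≤n)))
  ... | _ , i , i∈D , i∉S = add i i∉S′ (toReach s (⊕-⊆ S⊆D ([]=⇒lookup i∈D))
          (trans e (trans (ℕₚ.+-suc ∣ S ∣ s) (cong (ℕ._+ s) (sym (∣⊕∣ S i i∉S′))))))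
    where
    i∉S′ : lookup S i ≡ false
    i∉S′ with lookup S i in eq
    ... | false = refl
    ... | true  = ⊥-elim (i∉S (lookup⇒[]= i S eq))

  δ : Subset n → Subset n → ℤ
  δ D S = ⟦ does (S ≟ˢ D) ⟧

  -- A chain from S through D adds the s elements of D outside S in any order and then the other r
  -- in any order.
  H-δ : ∀ s r {S D : Subset n} → S ⊆ D → ∣ D ∣ ≡ ∣ S ∣ ℕ.+ s → ∣ S ∣ ℕ.+ (s ℕ.+ r) ≡ n →
    + (s ! ℕ.* r !) ≤ H (δ D) (s ℕ.+ r) S
  H-δ zero r {S} {D} S⊆D e _ with ⊆∧≡⇒≡ S⊆D (sym (trans e (ℕₚ.+-identityʳ _)))
  ... | refl = ℤₚ.≤-trans (ℤₚ.≤-reflexive (cong +_ (ℕₚ.+-identityʳ (r !)))) (self r)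
    where
    self : ∀ r → + (r !) ≤ H (δ S) r S
    self zero = ℤₚ.≤-reflexive (cong ⟦_⟧ (sym (dec-true (S ≟ˢ S) refl)))
    self (suc r) = ℤₚ.≤-trans (ℤₚ.≤-reflexive (sym (trans (ℤₚ.+-identityʳ _)
        (trans (cong (λ b → + (suc r !) * ⟦ b ⟧) (dec-true (S ≟ˢ S) refl)) (ℤₚ.*-identityʳ (+ (suc r !)))))))
      (ℤₚ.+-monoʳ-≤ (+ (suc r !) * δ S S) (Σ∉-nonNeg S (λ i _ → H-nonNeg r (S ⊕ i) (λ T → ⟦⟧≥0 (does (T ≟ˢ S))))))
  H-δ (suc s) r {S} {D} S⊆D e sz = begin
    + (suc s ! ℕ.* r !)
      ≡⟨ cong +_ (ℕₚ.*-assoc (suc s) (s !) (r !)) ⟩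
    + (suc s ℕ.* (s ! ℕ.* r !))
      ≡⟨ ℤₚ.pos-* (suc s) (s ! ℕ.* r !) ⟩
    + suc s * c
      -- `Ψ` of a constant counts the elements of D outside S, the possible first steps towards D.
      ≡⟨ sym (Ψ-const c (toReach (suc s) S⊆D e)) ⟩
    Ψ (λ _ _ → c) S D
      ≤⟨ Σ∉-mono S term ⟩
    Σ∉ S (λ i → H (δ D) (s ℕ.+ r) (S ⊕ i))
      ≡⟨ sym (ℤₚ.+-identityˡ _) ⟩
    0ℤ + Σ∉ S (λ i → H (δ D) (s ℕ.+ r) (S ⊕ i))
      ≤⟨ ℤₚ.+-monoˡ-≤ _ (*-nonNeg ((suc s ℕ.+ r) !) (⟦⟧≥0 (does (S ≟ˢ D)))) ⟩
    H (δ D) (suc s ℕ.+ r) S ∎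
    where
    open ℤₚ.≤-Reasoning
    c : ℤ
    c = + (s ! ℕ.* r !)
    term : ∀ i → lookup S i ≡ false → pick (not (lookup D i)) c ≤ H (δ D) (s ℕ.+ r) (S ⊕ i)
    term i i∉S with lookup D i in eq
    ... | false = H-nonNeg (s ℕ.+ r) (S ⊕ i) (λ T → ⟦⟧≥0 (does (T ≟ˢ D)))
    ... | true  = H-δ s r (⊕-⊆ S⊆D eq) (trans e (trans (ℕₚ.+-suc ∣ S ∣ s) (cong (ℕ._+ s) (sym (∣⊕∣ S i i∉S)))))
                    (size-⊕ S i i∉S sz)

  -- Pairs of a member and a maximal chain through it: `n !` times the Lubell function.
  chains : List (Subset n) → ℕ
  chains []          = 0
  chains {n} (D ∷ F) = ∣ D ∣ ! ℕ.* (n ℕ.∸ ∣ D ∣) ! ℕ.+ chains F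

  chains≤H : (F : List (Subset n)) → Unique F → + chains F ≤ H χ[ F ] n ∅
  chains≤H {n} []      _ = H-nonNeg n ∅ (λ _ → ℤₚ.≤-refl)
  chains≤H {n} (D ∷ F) (D∉F ∷ u) = begin
    + (∣ D ∣ ! ℕ.* (n ℕ.∸ ∣ D ∣) !) + + chains F
      ≤⟨ ℤₚ.+-mono-≤ single (chains≤H F u) ⟩
    H (δ D) n ∅ + H χ[ F ] n ∅
      ≡⟨ sym (H-+ (δ D) χ[ F ] n ∅) ⟩
    H (λ S → δ D S + χ[ F ] S) n ∅
      ≤⟨ H-mono n ∅ pointwise ⟩
    H χ[ D ∷ F ] n ∅ ∎
    where
    open ℤₚ.≤-Reasoning
    split : ∣ D ∣ ℕ.+ (n ℕ.∸ ∣ D ∣) ≡ n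
    split = ℕₚ.m+[n∸m]≡n (∣p∣≤n D)
    single : + (∣ D ∣ ! ℕ.* (n ℕ.∸ ∣ D ∣) !) ≤ H (δ D) n ∅
    single = subst (λ r → + (∣ D ∣ ! ℕ.* (n ℕ.∸ ∣ D ∣) !) ≤ H (δ D) r ∅) split
      (H-δ ∣ D ∣ (n ℕ.∸ ∣ D ∣) (⊥⊆ {p = D}) (cong (ℕ._+ ∣ D ∣) (sym (∣⊥∣≡0 n)))
        (trans (cong (ℕ._+ (∣ D ∣ ℕ.+ (n ℕ.∸ ∣ D ∣))) (∣⊥∣≡0 n)) split))
    pointwise : ∀ S → δ D S + χ[ F ] S ≤ χ[ D ∷ F ] S
    pointwise S with S ≟ˢ D | mem F S in eq
    ... | no  _    | b     = ℤₚ.≤-reflexive (ℤₚ.+-identityˡ ⟦ b ⟧)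
    ... | yes _    | false = ℤₚ.≤-refl
    -- Absence of repetitions is what keeps the indicators from adding up to 2.
    ... | yes refl | true  = ⊥-elim (All.lookup D∉F (mem-true⁻ F S eq) refl)

  -- Used with c the central coefficient: y = 1 for arbitrary members, y = X for members on sparse
  -- levels near the full set.
  length≤chains : ∀ {y c} (F : List (Subset n)) →
    All (λ D → y ℕ.* n ! ℕ.≤ ∣ D ∣ ! ℕ.* (n ℕ.∸ ∣ D ∣) ! ℕ.* c) F →
    length F ℕ.* (y ℕ.* n !) ℕ.≤ chains F ℕ.* c
  length≤chains []      []       = z≤n
  length≤chains {n} {y} {c} (D ∷ F) (p ∷ ps) = ℕₚ.≤-trans (ℕₚ.+-mono-≤ p (length≤chains {y = y} F ps))
    (ℕₚ.≤-reflexive (sym (ℕₚ.*-distribʳ-+ c (∣ D ∣ ! ℕ.* (n ℕ.∸ ∣ D ∣) !) (chains F))))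

  -- A bound that holds at the members propagates downwards, as H at a non-member is a sum over its upper covers.
  H-average : ∀ {χ : Subset n → ℤ} (m : ℕ) (c : ℤ) → 0ℤ ≤ c →
    (∀ r S → ∣ S ∣ ℕ.+ r ≡ n → χ S ≡ 0ℤ ⊎ + m * H χ r S ≤ c * + (r !)) →
    ∀ r S → ∣ S ∣ ℕ.+ r ≡ n → + m * H χ r S ≤ c * + (r !)
  H-average {n} {χ} m c 0≤c members r S e with members r S e
  ... | inj₂ p = p
  ... | inj₁ χ≡0 = average r S e χ≡0
    where
    average : ∀ r S → ∣ S ∣ ℕ.+ r ≡ n → χ S ≡ 0ℤ → + m * H χ r S ≤ c * + (r !)
    average zero S e χ≡0 = ℤₚ.≤-trans (ℤₚ.≤-reflexive (trans (cong (+ m *_) χ≡0) (ℤₚ.*-zeroʳ (+ m))))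
      (ℤₚ.≤-trans 0≤c (ℤₚ.≤-reflexive (sym (ℤₚ.*-identityʳ c))))
    average (suc r) S e χ≡0 = begin
      + m * (+ (suc r !) * χ S + Σ∉ S (λ i → H χ r (S ⊕ i)))
        ≡⟨ cong (λ x → + m * (+ (suc r !) * x + Σ∉ S (λ i → H χ r (S ⊕ i)))) χ≡0 ⟩
      + m * (+ (suc r !) * 0ℤ + Σ∉ S (λ i → H χ r (S ⊕ i)))
        ≡⟨ drop (+ m) (+ (suc r !)) _ ⟩
      + m * Σ∉ S (λ i → H χ r (S ⊕ i))
        ≡⟨ sym (Σ∉-* S (+ m) _) ⟩
      Σ∉ S (λ i → + m * H χ r (S ⊕ i))
        ≤⟨ Σ∉-mono S (λ i p → H-average m c 0≤c members r (S ⊕ i) (size-⊕ S i p e)) ⟩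
      Σ∉ S (λ _ → c * + (r !))
        ≡⟨ Σ∉-const S e _ ⟩
      + suc r * (c * + (r !))
        ≡⟨ swap (+ suc r) c (+ (r !)) ⟩
      c * (+ suc r * + (r !))
        ≡⟨ cong (c *_) (sym (ℤₚ.pos-* (suc r) (r !))) ⟩
      c * + (suc r !) ∎
      where
      open ℤₚ.≤-Reasoning
      drop : ∀ a b x → a * (b * 0ℤ + x) ≡ a * x
      drop = solve-∀
      swap : ∀ a b x → a * (b * x) ≡ b * (a * x)
      swap = solve-∀

  -- From the first member met fewer than L steps remain, so a chain contains at most L sets from
  -- there on.
  H-thin : (F : List (Subset n)) (L : ℕ) → All (λ D → n ℕ.∸ ∣ D ∣ ℕ.< L) F →
    ∀ r S → ∣ S ∣ ℕ.+ r ≡ n → + 1 * H χ[ F ] r S ≤ + L * + (r !)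
  H-thin {n} F L thin = H-average 1 (+ L) (+≤+ z≤n) members
    where
    every-level : ∀ r S → ∣ S ∣ ℕ.+ r ≡ n → H χ[ F ] r S ≤ + suc r * + (r !)
    every-level zero    S _ = ⟦⟧≤1 (mem F S)
    every-level (suc r) S e = begin
      + (suc r !) * χ[ F ] S + Σ∉ S (λ i → H χ[ F ] r (S ⊕ i))
        ≤⟨ ℤₚ.+-mono-≤ (ℤₚ.*-monoˡ-≤-nonNeg (+ (suc r !)) (⟦⟧≤1 (mem F S)))
             (Σ∉-mono S (λ i p → every-level r (S ⊕ i) (size-⊕ S i p e))) ⟩
      + (suc r !) * 1ℤ + Σ∉ S (λ _ → + suc r * + (r !))
        ≡⟨ cong (λ x → + (suc r !) * 1ℤ + x) (trans (Σ∉-const S e _) (cong (+ suc r *_) (sym (ℤₚ.pos-* (suc r) (r !))))) ⟩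
      + (suc r !) * 1ℤ + + suc r * + (suc r !)
        ≡⟨ cong (_+ + suc r * + (suc r !)) (ℤₚ.*-identityʳ (+ (suc r !))) ⟩
      + (suc r !) + + suc r * + (suc r !)
        ≡⟨ sym (ℤₚ.suc-* (+ suc r) (+ (suc r !))) ⟩
      + suc (suc r) * + (suc r !) ∎
      where open ℤₚ.≤-Reasoning
    members : ∀ r S → ∣ S ∣ ℕ.+ r ≡ n → χ[ F ] S ≡ 0ℤ ⊎ + 1 * H χ[ F ] r S ≤ + L * + (r !)
    members r S e with mem F S in eq
    ... | false = inj₁ refl
    ... | true  = inj₂ (ℤₚ.≤-trans (ℤₚ.≤-reflexive (ℤₚ.*-identityˡ _)) (ℤₚ.≤-trans (every-level r S e)
            (ℤₚ.*-monoʳ-≤-nonNeg (+ (r !)) (+≤+ (subst (ℕ._< L) (trans (cong (ℕ._∸ ∣ S ∣) (sym e)) (ℕₚ.m+n∸m≡n ∣ S ∣ r))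
              (All.lookup thin (mem-true⁻ F S eq)))))))

  -- The error 1 / (4 (p + 1)) of `chain-bound` decreases with p, so its value at p = k serves every
  -- member of depth at least 4 + k, and `H-average` spreads the bound to all sets.
  H-diamondFree : (F : List (Subset n)) → DiamondFree F → (k : ℕ) → All (λ D → 4 ℕ.+ k ℕ.≤ n ℕ.∸ ∣ D ∣) F →
    ∀ r S → ∣ S ∣ ℕ.+ r ≡ n → + (4 ℕ.* suc k) * H χ[ F ] r S ≤ (+ 9 * + suc k + 1ℤ) * + (r !)
  H-diamondFree {n} F diamondFree k deep = H-average (4 ℕ.* suc k) (+ 9 * + suc k + 1ℤ) (+≤+ z≤n) members
    where
    members : ∀ r S → ∣ S ∣ ℕ.+ r ≡ n → χ[ F ] S ≡ 0ℤ ⊎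
      + (4 ℕ.* suc k) * H χ[ F ] r S ≤ (+ 9 * + suc k + 1ℤ) * + (r !)
    members r S e with mem F S in eq
    ... | false = inj₁ refl
    ... | true  = inj₂ (subst (λ r → + (4 ℕ.* suc k) * H χ[ F ] r S ≤ (+ 9 * + suc k + 1ℤ) * + (r !)) r≡
            (member (trans (cong (∣ S ∣ ℕ.+_) r≡) e)))
      where
      4+k≤r : 4 ℕ.+ k ℕ.≤ r
      4+k≤r = subst (4 ℕ.+ k ℕ.≤_) (trans (cong (ℕ._∸ ∣ S ∣) (sym e)) (ℕₚ.m+n∸m≡n ∣ S ∣ r))
        (All.lookup deep (mem-true⁻ F S eq))
      p : ℕ
      p = k ℕ.+ (r ℕ.∸ (4 ℕ.+ k))
      r≡ : 4 ℕ.+ p ≡ r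
      r≡ = ℕₚ.m+[n∸m]≡n 4+k≤r
      K≤P : + suc k ≤ + suc p
      K≤P = +≤+ (s≤s (ℕₚ.m≤m+n k _))
      member : ∣ S ∣ ℕ.+ (4 ℕ.+ p) ≡ n →
        + (4 ℕ.* suc k) * H χ[ F ] (4 ℕ.+ p) S ≤ (+ 9 * + suc k + 1ℤ) * + ((4 ℕ.+ p) !)
      member e′ = ℤₚ.*-cancelˡ-≤-pos _ _ (+ suc p) (begin
        + suc p * (+ (4 ℕ.* suc k) * h)
          ≡⟨ trans (cong (λ x → + suc p * (x * h)) (ℤₚ.pos-* 4 (suc k))) (r₁ (+ suc p) (+ suc k) h) ⟩
        + suc k * (+ 4 * (+ suc p * h))
          ≤⟨ ℤₚ.*-monoˡ-≤-nonNeg (+ suc k) (Link.chain-bound F diamondFree S (mem-true⁻ F S eq) p e′) ⟩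
        + suc k * ((+ 9 * + suc p + 1ℤ) * m)
          ≡⟨ r₂ (+ suc k) (+ suc p) m ⟩
        + 9 * + suc p * + suc k * m + + suc k * m
          ≤⟨ ℤₚ.+-monoʳ-≤ (+ 9 * + suc p * + suc k * m) (ℤₚ.*-monoʳ-≤-nonNeg m K≤P) ⟩
        + 9 * + suc p * + suc k * m + + suc p * m
          ≡⟨ r₃ (+ suc k) (+ suc p) m ⟩
        + suc p * ((+ 9 * + suc k + 1ℤ) * m) ∎)
        where
        open ℤₚ.≤-Reasoning
        h m : ℤ
        h = H χ[ F ] (4 ℕ.+ p) S
        m = + ((4 ℕ.+ p) !)
        r₁ : ∀ P K h → P * (+ 4 * K * h) ≡ K * (+ 4 * (P * h))
        r₁ = solve-∀
        r₂ : ∀ K P m → K * ((+ 9 * P + 1ℤ) * m) ≡ + 9 * P * K * m + K * m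
        r₂ = solve-∀
        r₃ : ∀ K P m → + 9 * P * K * m + P * m ≡ P * ((+ 9 * K + 1ℤ) * m)
        r₃ = solve-∀

-- Splitting the family by distance from the full set

length-filter-split : ∀ {a p} {A : Set a} {P : Pred A p} (P? : Decidable P) (xs : List A) →
  length xs ≡ length (filter P? xs) ℕ.+ length (filter (λ x → ¬? (P? x)) xs)
length-filter-split P? [] = refl
length-filter-split P? (x ∷ xs) with P? x
... | yes _ = cong suc (length-filter-split P? xs)
... | no  _ = trans (cong suc (length-filter-split P? xs)) (sym (ℕₚ.+-suc _ _))

DiamondFree-filter : ∀ {n p} {P : Pred (Subset n) p} (P? : Decidable P) (F : List (Subset n)) →
  DiamondFree F → DiamondFree (filter P? F)
DiamondFree-filter P? F df (A , B , C , D , A∈ , B∈ , C∈ , D∈ , rest) =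
  df (A , B , C , D , original A∈ , original B∈ , original C∈ , original D∈ , rest)
  where
  original : ∀ {S} → S ∈ filter P? F → S ∈ F
  original S∈ = proj₁ (∈-filter⁻ P? {xs = F} S∈)

deep-bound : ∀ {n} (F : List (Subset n)) → Unique F → DiamondFree F → (k : ℕ) →
  All (λ D → 4 ℕ.+ k ℕ.≤ n ℕ.∸ ∣ D ∣) F → 4 ℕ.* suc k ℕ.* length F ℕ.≤ (9 ℕ.* suc k ℕ.+ 1) ℕ.* central n
deep-bound {n} F u df k deep = ℕₚ.*-cancelʳ-≤ _ _ (n !) (begin
  4 ℕ.* suc k ℕ.* length F ℕ.* n !                 ≡⟨ r₁ (4 ℕ.* suc k) (length F) (n !) ⟩
  4 ℕ.* suc k ℕ.* (length F ℕ.* (1 ℕ.* n !))       ≤⟨ ℕₚ.*-monoʳ-≤ (4 ℕ.* suc k) (length≤chains {y = 1} F (All.universal size F)) ⟩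
  4 ℕ.* suc k ℕ.* (chains F ℕ.* central n)         ≡⟨ sym (ℕₚ.*-assoc (4 ℕ.* suc k) (chains F) (central n)) ⟩
  4 ℕ.* suc k ℕ.* chains F ℕ.* central n           ≤⟨ ℕₚ.*-monoˡ-≤ (central n) lubell ⟩
  (9 ℕ.* suc k ℕ.+ 1) ℕ.* n ! ℕ.* central n        ≡⟨ r₂ (9 ℕ.* suc k ℕ.+ 1) (n !) (central n) ⟩
  (9 ℕ.* suc k ℕ.+ 1) ℕ.* central n ℕ.* n !        ∎)
  where
  open ℕₚ.≤-Reasoning
  instance _ = ℕₚ._!≢0 n
  r₁ : ∀ a b c → a ℕ.* b ℕ.* c ≡ a ℕ.* (b ℕ.* (1 ℕ.* c))
  r₁ = solveℕ-∀
  r₂ : ∀ a b c → a ℕ.* b ℕ.* c ≡ a ℕ.* c ℕ.* b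
  r₂ = solveℕ-∀
  size : ∀ D → 1 ℕ.* n ! ℕ.≤ ∣ D ∣ ! ℕ.* (n ℕ.∸ ∣ D ∣) ! ℕ.* central n
  size D = ℕₚ.≤-trans (ℕₚ.≤-reflexive (ℕₚ.*-identityˡ (n !)))
    (subst (λ m → m ! ℕ.≤ ∣ D ∣ ! ℕ.* (n ℕ.∸ ∣ D ∣) ! ℕ.* central m) (ℕₚ.m+[n∸m]≡n (∣p∣≤n D))
      (n!≤central ∣ D ∣ (n ℕ.∸ ∣ D ∣)))
  lubell : 4 ℕ.* suc k ℕ.* chains F ℕ.≤ (9 ℕ.* suc k ℕ.+ 1) ℕ.* n !
  lubell = ℤₚ.drop‿+≤+ (ℤₚ.≤-trans (ℤₚ.≤-reflexive (ℤₚ.pos-* (4 ℕ.* suc k) (chains F)))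
    (ℤₚ.≤-trans (ℤₚ.*-monoˡ-≤-nonNeg (+ (4 ℕ.* suc k)) (chains≤H F u))
    (ℤₚ.≤-trans (H-diamondFree F df k deep n ∅ (cong (ℕ._+ n) (∣⊥∣≡0 n)))
    (ℤₚ.≤-reflexive (trans (cong (λ x → (x ℤ.+ 1ℤ) ℤ.* + (n !)) (sym (ℤₚ.pos-* 9 (suc k))))
      (sym (ℤₚ.pos-* (9 ℕ.* suc k ℕ.+ 1) (n !))))))))

-- The Lubell function is at most L + 1, while each member contributes at least X / `central n` to
-- it.
thin-bound : ∀ {n} (F : List (Subset n)) → Unique F → (X L : ℕ) → X ℕ.* suc L ℕ.+ suc L ℕ.≤ n →
  All (λ D → n ℕ.∸ ∣ D ∣ ℕ.< suc L) F → length F ℕ.* X ℕ.≤ suc L ℕ.* central n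
thin-bound {n} F u X L n≥ thin = ℕₚ.*-cancelʳ-≤ _ _ (n !) (begin
  length F ℕ.* X ℕ.* n !              ≡⟨ ℕₚ.*-assoc (length F) X (n !) ⟩
  length F ℕ.* (X ℕ.* n !)            ≤⟨ length≤chains {y = X} F (All.map (λ {D} → size D) thin) ⟩
  chains F ℕ.* central n              ≤⟨ ℕₚ.*-monoˡ-≤ (central n) lubell ⟩
  suc L ℕ.* n ! ℕ.* central n         ≡⟨ r₁ (suc L) (n !) (central n) ⟩
  suc L ℕ.* central n ℕ.* n !         ∎)
  where
  open ℕₚ.≤-Reasoning
  instance _ = ℕₚ._!≢0 n
  r₁ : ∀ a b c → a ℕ.* b ℕ.* c ≡ a ℕ.* c ℕ.* b
  r₁ = solveℕ-∀
  large : ∀ m j → m ℕ.+ j ≡ n → X ℕ.* suc j ℕ.< m → X ℕ.* n ! ℕ.≤ m ! ℕ.* j ! ℕ.* central n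
  large (suc m) j refl X<m = X*n!≤central X m j (ℕₚ.<⇒≤ X<m)
  size : ∀ (D : Subset n) → n ℕ.∸ ∣ D ∣ ℕ.< suc L → X ℕ.* n ! ℕ.≤ ∣ D ∣ ! ℕ.* (n ℕ.∸ ∣ D ∣) ! ℕ.* central n
  -- The required `X * suc j < ∣ D ∣` is checked after adding `suc j` to both sides, which turns the
  -- right side into n + 1.
  size D j<L = large ∣ D ∣ j split (ℕₚ.+-cancelʳ-≤ (suc j) _ _ (begin
      suc (X ℕ.* suc j) ℕ.+ suc j        ≤⟨ s≤s (ℕₚ.+-mono-≤ (ℕₚ.*-monoʳ-≤ X j<L) j<L) ⟩
      suc (X ℕ.* suc L ℕ.+ suc L)        ≤⟨ s≤s n≥ ⟩
      suc n                              ≡⟨ cong suc (sym split) ⟩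
      suc (∣ D ∣ ℕ.+ j)                  ≡⟨ sym (ℕₚ.+-suc ∣ D ∣ j) ⟩
      ∣ D ∣ ℕ.+ suc j                    ∎))
    where
    j : ℕ
    j = n ℕ.∸ ∣ D ∣
    split : ∣ D ∣ ℕ.+ j ≡ n
    split = ℕₚ.m+[n∸m]≡n (∣p∣≤n D)
  lubell : chains F ℕ.≤ suc L ℕ.* n !
  lubell = ℤₚ.drop‿+≤+ (ℤₚ.≤-trans (chains≤H F u) (ℤₚ.≤-trans (ℤₚ.≤-reflexive (sym (ℤₚ.*-identityˡ _)))
    (ℤₚ.≤-trans (H-thin F (suc L) thin n ∅ (cong (ℕ._+ n) (∣⊥∣≡0 n)))
      (ℤₚ.≤-reflexive (sym (ℤₚ.pos-* (suc L) (n !)))))))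

-- The condition of `thin-bound` for L + 1 = 4 + k and X = 2 (k + 1) (4 + k). The thin members then
-- number at most `central n` / (2 (k + 1)), which adds 2 to the 1 from `deep-bound` and makes the 3
-- below.
threshold : ℕ → ℕ
threshold k = 2 ℕ.* suc k ℕ.* (4 ℕ.+ k) ℕ.* (4 ℕ.+ k) ℕ.+ (4 ℕ.+ k)

diamondFree-bound : ∀ {n} (F : List (Subset n)) → Unique F → DiamondFree F → (k : ℕ) → threshold k ℕ.≤ n →
  4 ℕ.* suc k ℕ.* length F ℕ.≤ (9 ℕ.* suc k ℕ.+ 3) ℕ.* central n
diamondFree-bound {n} F u df k n≥ = begin
  4 ℕ.* suc k ℕ.* length F
    ≡⟨ cong (4 ℕ.* suc k ℕ.*_) (length-filter-split deep? F) ⟩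
  4 ℕ.* suc k ℕ.* (length F₁ ℕ.+ length F₂)
    ≡⟨ r₁ (suc k) (length F₁) (length F₂) ⟩
  4 ℕ.* suc k ℕ.* length F₁ ℕ.+ 2 ℕ.* (length F₂ ℕ.* (2 ℕ.* suc k))
    ≤⟨ ℕₚ.+-mono-≤ (deep-bound F₁ (filter⁺ deep? u) (DiamondFree-filter deep? F df) k (all-filter deep? F))
         (ℕₚ.*-monoʳ-≤ 2 thin) ⟩
  (9 ℕ.* suc k ℕ.+ 1) ℕ.* central n ℕ.+ 2 ℕ.* central n
    ≡⟨ r₂ (9 ℕ.* suc k) (central n) ⟩
  (9 ℕ.* suc k ℕ.+ 3) ℕ.* central n ∎
  where
  open ℕₚ.≤-Reasoning
  deep? : Decidable (λ D → 4 ℕ.+ k ℕ.≤ n ℕ.∸ ∣ D ∣)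
  deep? D = (4 ℕ.+ k) ℕₚ.≤? (n ℕ.∸ ∣ D ∣)
  F₁ F₂ : List (Subset n)
  F₁ = filter deep? F
  F₂ = filter (λ D → ¬? (deep? D)) F
  r₁ : ∀ K x y → 4 ℕ.* K ℕ.* (x ℕ.+ y) ≡ 4 ℕ.* K ℕ.* x ℕ.+ 2 ℕ.* (y ℕ.* (2 ℕ.* K))
  r₁ = solveℕ-∀
  r₂ : ∀ x c → (x ℕ.+ 1) ℕ.* c ℕ.+ 2 ℕ.* c ≡ (x ℕ.+ 3) ℕ.* c
  r₂ = solveℕ-∀
  r₃ : ∀ x K L → L ℕ.* (x ℕ.* K) ≡ x ℕ.* (K ℕ.* L)
  r₃ = solveℕ-∀
  thin : length F₂ ℕ.* (2 ℕ.* suc k) ℕ.≤ central n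
  thin = ℕₚ.*-cancelˡ-≤ (4 ℕ.+ k) (ℕₚ.≤-trans
    (ℕₚ.≤-reflexive (r₃ (length F₂) (2 ℕ.* suc k) (4 ℕ.+ k)))
    (thin-bound F₂ (filter⁺ (λ D → ¬? (deep? D)) u) (2 ℕ.* suc k ℕ.* (4 ℕ.+ k)) (3 ℕ.+ k) n≥
      (All.map ℕₚ.≰⇒> (all-filter (λ D → ¬? (deep? D)) F))))

-- From natural numbers to the rational statement

open import Data.Nat using (_≤_)
open import Data.Rational using (ℚ; mkℚ; Positive; _/_; _+_; _*_; toℚᵘ) renaming (_≤_ to _≤ℚ_)
import Data.Rational.Properties as ℚₚ
open import Data.Rational.Unnormalised as ℚᵘ using (mkℚᵘ; *≤*)
import Data.Rational.Unnormalised.Properties as ℚᵘₚ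

theorem2 : (δ : ℚ) → Positive δ →
    Σ ℕ λ N → (n : ℕ) → 1 ≤ n → N ≤ n →
    (F : List (Subset n)) → Unique F → DiamondFree F →
    ((+ length F) / 1) ≤ℚ (((+ 9) / 4) + δ) * ((+ (n C ⌊ n /2⌋)) / 1)
-- Here δ = (a + 1) / (k + 1), and its denominator fixes the depth: the error 3 / (4 (k + 1)) is at
-- most δ because 3 ≤ 4 (a + 1). Unnormalised rationals reduce the claim to this
-- cross-multiplication.
theorem2 δ@(mkℚ (+ suc a) k _) _ = threshold k , λ n _ n≥ F u df →
  ℚₚ.toℚᵘ-cancel-≤ (ℚᵘₚ.≤-respˡ-≃ (ℚᵘₚ.≃-sym (ℚₚ.toℚᵘ-fromℚᵘ (mkℚᵘ (+ length F) 0)))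
    (ℚᵘₚ.≤-respʳ-≃ (ℚᵘₚ.≃-sym (rhs (central n))) (*≤* (cross n F (diamondFree-bound F u df k n≥)))))
  where
  rhs : ∀ c → toℚᵘ ((((+ 9) / 4) + δ) * ((+ c) / 1)) ℚᵘ.≃
              (mkℚᵘ (+ 9) 3 ℚᵘ.+ mkℚᵘ (+ suc a) k) ℚᵘ.* mkℚᵘ (+ c) 0
  rhs c = ℚᵘₚ.≃-trans (ℚₚ.toℚᵘ-homo-* (((+ 9) / 4) + δ) ((+ c) / 1))
    (ℚᵘₚ.*-cong (ℚᵘₚ.≃-trans (ℚₚ.toℚᵘ-homo-+ ((+ 9) / 4) δ) ℚᵘₚ.≃-refl) (ℚₚ.toℚᵘ-fromℚᵘ (mkℚᵘ (+ c) 0)))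
  cross : ∀ n (F : List (Subset n)) → 4 ℕ.* suc k ℕ.* length F ℕ.≤ (9 ℕ.* suc k ℕ.+ 3) ℕ.* central n →
    + length F ℤ.* + (4 ℕ.* suc k ℕ.* 1) ℤ.≤ ((+ 9 ℤ.* + suc k ℤ.+ + suc a ℤ.* + 4) ℤ.* + central n) ℤ.* + 1
  cross n F p = begin
    + length F ℤ.* + (4 ℕ.* suc k ℕ.* 1)
      ≡⟨ sym (ℤₚ.pos-* (length F) (4 ℕ.* suc k ℕ.* 1)) ⟩
    + (length F ℕ.* (4 ℕ.* suc k ℕ.* 1))
      ≤⟨ +≤+ (ℕₚ.≤-trans (ℕₚ.≤-reflexive (r₁ (length F) (suc k))) (ℕₚ.≤-trans p
           (ℕₚ.*-monoˡ-≤ (central n) (ℕₚ.+-monoʳ-≤ (9 ℕ.* suc k) 3≤4a)))) ⟩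
    + ((9 ℕ.* suc k ℕ.+ suc a ℕ.* 4) ℕ.* central n)
      ≡⟨ ℤₚ.pos-* (9 ℕ.* suc k ℕ.+ suc a ℕ.* 4) (central n) ⟩
    + (9 ℕ.* suc k ℕ.+ suc a ℕ.* 4) ℤ.* + central n
      ≡⟨ cong (ℤ._* + central n) (cong₂ ℤ._+_ (ℤₚ.pos-* 9 (suc k)) (ℤₚ.pos-* (suc a) 4)) ⟩
    (+ 9 ℤ.* + suc k ℤ.+ + suc a ℤ.* + 4) ℤ.* + central n
      ≡⟨ sym (ℤₚ.*-identityʳ _) ⟩
    ((+ 9 ℤ.* + suc k ℤ.+ + suc a ℤ.* + 4) ℤ.* + central n) ℤ.* + 1 ∎
    where
    open ℤₚ.≤-Reasoning
    r₁ : ∀ x K → x ℕ.* (4 ℕ.* K ℕ.* 1) ≡ 4 ℕ.* K ℕ.* x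
    r₁ = solveℕ-∀
    3≤4a : 3 ℕ.≤ suc a ℕ.* 4
    3≤4a = s≤s (s≤s (s≤s z≤n))
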